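{- Let $k\ge d\ge 3$ be fixed and $n\ge 3k^5$. Suppose that $\mathcal{F}\subset\binom{[n]}{k}$ is a $(d,2k+d-3)$-conditionally intersecting family. Then $|\mathcal{F}|\le\binom{n-1}{k-1}$.
   Context: $[n]=\{1,\ldots,n\}$, and $\binom{[n]}{k}$ denotes the collection of all $k$-element subsets of $[n]$. A family $\mathcal{F}\subset\binom{[n]}{k}$ is called $(d,s)$-conditionally intersecting if there do not exist $d$ distinct sets $A_1,\ldots,A_d\in\mathcal{F}$ with $|A_1\cup\cdots\cup A_d|\le s$ and $A_1\cap\cdots\cap A_d=\emptyset$. -}

module Defs where

open import Data.Fin.Subset using (Subset; ∣_∣; ⋃; ⋂; Empty)
open import Data.List.Base using (List; length)
open import Data.List.Membership.Propositional using (_∈_)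
open import Data.List.Relation.Unary.All using (All)
open import Data.List.Relation.Unary.Unique.Propositional using (Unique)
open import Data.Nat.Base using (ℕ; _≤_)
open import Data.Product.Base using (_×_; ∃-syntax)
open import Relation.Binary.PropositionalEquality using (_≡_)
open import Relation.Nullary.Negation using (¬_)

-- A family of k-element subsets of an n-element ground set, given by a
-- list without repetitions; the order of the list carries no meaning.
record Family (n k : ℕ) : Set where
  field
    members : List (Subset n)
    unique  : Unique members
    uniform : All (λ A → ∣ A ∣ ≡ k) members

open Family public

-- Since `unique` holds, this is the cardinality of the family.
size : ∀ {n k} → Family n k → ℕ
size F = length (members F)

ConditionallyIntersecting : ∀ {n k} → ℕ → ℕ → Family n k → Set
ConditionallyIntersecting d s F =
  ¬ (∃[ As ] length As ≡ d
           × Unique As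
           × All (_∈ members F) As
           × ∣ ⋃ As ∣ ≤ s
           × Empty (⋂ As))

{-# OPTIONS --safe #-}
module Submission where

-- Put N = n - k + 1.  Call a (k-1)-set T private if exactly one member of F
-- contains it, and call A ∈ F full if it contains no private T.
--
-- Every T has degree at most N, so counting pairs T ⊂ B ∈ F gives
-- k |F| + (N - 1) #private ≤ N C(n,k-1).  If no member is full, then
-- #private ≥ |F|, hence n |F| ≤ N C(n,k-1) = n C(n-1,k-1).
--
-- Full members are rare.  If A is full then |A ∩ B| ≠ 1 for all B ∈ F:
-- otherwise A, B and d - 2 members C ⊇ A - x, with x ∉ C and the point of
-- A ∩ B among these x, have empty intersection and at most 2k + d - 3 points
-- in their union.  It follows that at most k² C(n-3,k-3) full members pass
-- through a point.  Call T good if |T ∩ A| = 1 for some full A; there are many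
-- good T for each full A.  A good T has degree at most k, and if it lies in
-- B ∈ F then so does another good set.  Thus good sets either have small
-- degree without being private, or are surplus private sets of some B; both
-- save in the count above, by more than the full members cost.

open import Defs
open import Data.Bool.Properties using () renaming (_≟_ to _≟ᵇ_)
open import Data.Fin.Base using (Fin; zero; suc)
import Data.Fin.Properties as Fin
open import Data.Fin.Subset
open import Data.Fin.Subset.Properties
open import Data.List.Base using (List; []; _∷_; _++_; length; map; filter; allFin; take)
import Data.List.Membership.Propositional as L
open import Data.List.Membership.Propositional.Properties
  using (∈-filter⁺; ∈-filter⁻; ∈-allFin; ∈-++⁺ˡ; ∈-++⁺ʳ; ∈-map⁺)
open import Data.List.Properties using (map-tabulate; map-∘; map-++; length-take)
open import Data.List.Relation.Unary.All as All using (All; []; _∷_)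
import Data.List.Relation.Unary.All.Properties as All
import Data.List.Relation.Unary.AllPairs as AllPairs
open import Data.List.Relation.Unary.Any as Any using (Any; here; there)
open import Data.List.Relation.Unary.Unique.Propositional using (Unique)
import Data.List.Relation.Unary.Unique.Propositional.Properties as Unique
open import Data.Nat.Base hiding (∣_-_∣)
open import Data.Nat.Combinatorics
  using (_C_; nCk≡nC[n∸k]; nCn≡1; nC1≡n; nCk+nC[k+1]≡[n+1]C[k+1]; k>n⇒nCk≡0)
open import Data.Nat.ListAction using (sum)
open import Data.Nat.ListAction.Properties using (sum-++)
open import Data.Nat.Properties
open import Data.Nat.Tactic.RingSolver using (solve-∀)
open import Data.Product.Base using (_×_; _,_; ∃-syntax; proj₁; proj₂; map₁; map₂)
open import Data.Sum.Base using (inj₁; inj₂)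
open import Data.Vec.Base using ([]; _∷_; here; there)
open import Data.Vec.Properties using (≡-dec)
open import Function.Base using (_∘_; id)
open import Level using (0ℓ)
open import Relation.Binary.Definitions using (DecidableEquality)
open import Relation.Binary.PropositionalEquality hiding (J)
open import Relation.Nullary.Decidable using (Dec; yes; no; _×-dec_; ¬?)
open import Relation.Nullary.Negation using (¬_; contradiction)
open import Relation.Unary using (Pred; Decidable)

-- Binomial coefficients

k*nCk≡n*[n-1]C[k-1] : ∀ n k → suc k * (suc n C suc k) ≡ suc n * (n C k)
k*nCk≡n*[n-1]C[k-1] n zero = trans (*-identityˡ _) (trans (nC1≡n (suc n)) (sym (*-identityʳ (suc n))))
k*nCk≡n*[n-1]C[k-1] zero (suc k) = trans (cong (suc (suc k) *_) (k>n⇒nCk≡0 {1} {suc (suc k)} (s≤s (s≤s z≤n))))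
  (trans (*-zeroʳ k) (sym (cong (1 *_) (k>n⇒nCk≡0 {0} {suc k} (s≤s z≤n)))))
k*nCk≡n*[n-1]C[k-1] (suc n) (suc k) = begin
  suc (suc k) * (suc (suc n) C suc (suc k))
    ≡⟨ cong (suc (suc k) *_) (nCk+nC[k+1]≡[n+1]C[k+1] (suc n) (suc k)) ⟨
  suc (suc k) * (a + b)
    ≡⟨ expand k a b ⟩
  a + (suc k * a + suc (suc k) * b)
    ≡⟨ cong (a +_) (cong₂ _+_ (k*nCk≡n*[n-1]C[k-1] n k) (k*nCk≡n*[n-1]C[k-1] n (suc k))) ⟩
  a + (suc n * (n C k) + suc n * (n C suc k))
    ≡⟨ cong (a +_) (*-distribˡ-+ (suc n) (n C k) _) ⟨
  a + suc n * ((n C k) + (n C suc k))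
    ≡⟨ cong (λ z → a + suc n * z) (nCk+nC[k+1]≡[n+1]C[k+1] n k) ⟩
  suc (suc n) * a ∎
  where
  open ≡-Reasoning
  a = suc n C suc k
  b = suc n C suc (suc k)
  expand : ∀ k a b → suc (suc k) * (a + b) ≡ a + (suc k * a + suc (suc k) * b)
  expand = solve-∀

-- The upper index n is written `m + k`, so that n - k is `m` and nothing is truncated. Pascal's
-- rule removes (k+1) C(n,k) from the absorption identity.
[k+1]*nC[k+1]≡[n∸k]*nCk : ∀ m k → suc k * ((m + k) C suc k) ≡ m * ((m + k) C k)
[k+1]*nC[k+1]≡[n∸k]*nCk m k = +-cancelˡ-≡ (suc k * c) _ _ (begin
  suc k * c + suc k * ((m + k) C suc k)  ≡⟨ *-distribˡ-+ (suc k) c _ ⟨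
  suc k * (c + ((m + k) C suc k))        ≡⟨ cong (suc k *_) (nCk+nC[k+1]≡[n+1]C[k+1] (m + k) k) ⟩
  suc k * (suc (m + k) C suc k)          ≡⟨ k*nCk≡n*[n-1]C[k-1] (m + k) k ⟩
  suc (m + k) * c                        ≡⟨ expand m k c ⟩
  suc k * c + m * c                      ∎)
  where
  open ≡-Reasoning
  c = (m + k) C k
  expand : ∀ m k c → suc (m + k) * c ≡ suc k * c + m * c
  expand = solve-∀

nCk>0 : ∀ m k → 0 < (m + k) C k
nCk>0 m zero = s≤s z≤n
nCk>0 m (suc k) = begin
  1                                      ≤⟨ nCk>0 m k ⟩
  (m + k) C k                            ≤⟨ m≤m+n _ _ ⟩
  (m + k) C k + ((m + k) C suc k)        ≡⟨ nCk+nC[k+1]≡[n+1]C[k+1] (m + k) k ⟩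
  suc (m + k) C suc k                    ≡⟨ cong (_C suc k) (+-suc m k) ⟨
  (m + suc k) C suc k ∎
  where open ≤-Reasoning

C-monoˡ : ∀ m n k → m C k ≤ (n + m) C k
C-monoˡ m zero k = ≤-refl
C-monoˡ m (suc n) zero = ≤-refl
C-monoˡ m (suc n) (suc k) = begin
  m C suc k                         ≤⟨ C-monoˡ m n (suc k) ⟩
  (n + m) C suc k                   ≤⟨ m≤n+m _ _ ⟩
  (n + m) C k + ((n + m) C suc k)   ≡⟨ nCk+nC[k+1]≡[n+1]C[k+1] (n + m) k ⟩
  suc (n + m) C suc k ∎
  where open ≤-Reasoning

-- Telescoping Pascal's rule over j steps.
C-telescope : ∀ m j k → (j + m) C suc k ≤ m C suc k + j * ((j + m) C k)
C-telescope m zero k = m≤m+n _ _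
C-telescope m (suc j) k = begin
  suc (j + m) C suc k                                ≡⟨ nCk+nC[k+1]≡[n+1]C[k+1] (j + m) k ⟨
  (j + m) C k + ((j + m) C suc k)                    ≤⟨ +-monoʳ-≤ _ (C-telescope m j k) ⟩
  (j + m) C k + (m C suc k + j * ((j + m) C k))      ≡⟨ rearrange _ (m C suc k) j ⟩
  m C suc k + suc j * ((j + m) C k)                  ≤⟨ +-monoʳ-≤ (m C suc k) (*-monoʳ-≤ (suc j) (C-monoˡ (j + m) 1 k)) ⟩
  m C suc k + suc j * (suc (j + m) C k) ∎
  where
  open ≤-Reasoning
  rearrange : ∀ c a j → c + (a + j * c) ≡ a + suc j * c
  rearrange = solve-∀

-- By `C-telescope` the large coefficient `x` exceeds the small one by at most `j * y`, where `y`
-- has lower index one less. The ratio of `x` to `y` is at least 2j here, so that excess is at most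
-- half of `x`.
C-double : ∀ q j k → 2 * (j * k) ≤ q → (j + (q + k)) C k ≤ 2 * ((q + k) C k)
C-double q j zero _ = s≤s z≤n
C-double q j (suc k) 2jk≤q = +-cancelʳ-≤ x x (2 * a) (begin
  x + x              ≤⟨ +-mono-≤ x≤ x≤ ⟩
  (a + j * y) + (a + j * y) ≡⟨ rearrange a (j * y) ⟩
  2 * a + 2 * (j * y) ≤⟨ +-monoʳ-≤ (2 * a) 2jy≤x ⟩
  2 * a + x ∎)
  where
  open ≤-Reasoning
  a = (q + suc k) C suc k
  x = (j + (q + suc k)) C suc k
  y = (j + (q + suc k)) C k
  x≤ : x ≤ a + j * y
  x≤ = C-telescope (q + suc k) j k
  rearrange : ∀ a b → (a + b) + (a + b) ≡ 2 * a + 2 * b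
  rearrange = solve-∀
  e : j + (q + suc k) ≡ (j + suc q) + k
  e = lemma j q k where
    lemma : ∀ j q k → j + (q + suc k) ≡ (j + suc q) + k
    lemma = solve-∀
  2jy≤x : 2 * (j * y) ≤ x
  2jy≤x = *-cancelˡ-≤ (suc k) (begin
    suc k * (2 * (j * y))   ≡⟨ lemma (suc k) j y ⟩
    2 * (j * suc k) * y     ≤⟨ *-monoˡ-≤ y (≤-trans 2jk≤q (≤-trans (n≤1+n q) (m≤n+m (suc q) j))) ⟩
    (j + suc q) * y         ≡⟨ cong (λ z → (j + suc q) * (z C k)) e ⟩
    (j + suc q) * (((j + suc q) + k) C k) ≡⟨ [k+1]*nC[k+1]≡[n∸k]*nCk (j + suc q) k ⟨
    suc k * (((j + suc q) + k) C suc k) ≡⟨ cong (λ z → suc k * (z C suc k)) e ⟨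
    suc k * x ∎)
    where
    lemma : ∀ k j y → k * (2 * (j * y)) ≡ 2 * (j * k) * y
    lemma = solve-∀

-- Here k = 3 + j and n = (q + 2 + j) + k.
module _ (j q : ℕ) (4k⁴≤q : 4 * (3 + j) ^ 4 ≤ q) where
  private
    k = 3 + j
    m = (q + 2) + j
    c = m C j

  -- Prepares `C-double` with shift and lower index both `j`, which compares C(n-3,k-3) with `c`.
  j²-bound : 2 * (j * j) ≤ q
  j²-bound = ≤-trans (*-mono-≤ {2} {4} (s≤s (s≤s z≤n)) j*j≤k⁴) 4k⁴≤q
    where
    open ≤-Reasoning
    j*j≤k⁴ : j * j ≤ k ^ 4
    j*j≤k⁴ = begin
      j * j       ≤⟨ *-mono-≤ (m≤n+m j 3) (m≤n+m j 3) ⟩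
      k * k       ≡⟨ cong (k *_) (*-identityʳ k) ⟨
      k ^ 2       ≤⟨ ^-monoʳ-≤ k {2} {4} (s≤s (s≤s z≤n)) ⟩
      k ^ 4 ∎

  -- Instantiated with M full sets, J = Σ (privates B ∸ 1), and G good
  -- shadows, L of which are not private.
  exceptional-bound : ∀ M J L G →
    M * (k * (m C suc j)) ≤ G * (k * (k * (k * ((j + m) C j)))) →
    G ≤ 2 * J + (1 + k) * L →
    m * M ≤ m * J + q * L
  exceptional-bound M J L G pairs G≤ = begin
    -- The factor q + 2 = m - j is the one that the ratio of C(m,j+1) to C(m,j) produces in
    -- `cancelled`.
    m * M                        ≤⟨ *-monoˡ-≤ M m≤ ⟩
    2 * (q + 2) * M              ≡⟨ e₁ q M ⟩
    2 * (M * (q + 2))            ≤⟨ *-monoʳ-≤ 2 cancelled ⟩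
    2 * (2 * k ^ 4 * (J + L))    ≡⟨ e₂ (k ^ 4) (J + L) ⟩
    4 * k ^ 4 * (J + L)          ≤⟨ *-monoˡ-≤ (J + L) 4k⁴≤q ⟩
    q * (J + L)                  ≡⟨ *-distribˡ-+ q J L ⟩
    q * J + q * L                ≤⟨ +-monoˡ-≤ (q * L) (*-monoˡ-≤ J (≤-trans (m≤m+n q 2) (m≤m+n (q + 2) j))) ⟩
    m * J + q * L ∎
    where
    open ≤-Reasoning
    e₁ : ∀ q M → 2 * (q + 2) * M ≡ 2 * (M * (q + 2))
    e₁ = solve-∀
    e₂ : ∀ x y → 2 * (2 * x * y) ≡ 4 * x * y
    e₂ = solve-∀
    k≤q : k ≤ q
    k≤q = ≤-trans (≤-trans (m≤m*n k (k ^ 3) ⦃ m^n≢0 k 3 ⦄) (m≤n*m (k ^ 4) 4)) 4k⁴≤q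
    m≤ : m ≤ 2 * (q + 2)
    m≤ = begin
      (q + 2) + j             ≤⟨ +-monoʳ-≤ (q + 2) (≤-trans (m≤n+m j 3) (≤-trans k≤q (m≤m+n q 2))) ⟩
      (q + 2) + (q + 2)       ≡⟨ cong ((q + 2) +_) (+-identityʳ (q + 2)) ⟨
      2 * (q + 2) ∎
    G≤' : G ≤ (1 + k) * (J + L)
    G≤' = begin
      G                          ≤⟨ G≤ ⟩
      2 * J + (1 + k) * L        ≤⟨ +-monoˡ-≤ _ (*-monoˡ-≤ J {2} {1 + k} (s≤s (s≤s z≤n))) ⟩
      (1 + k) * J + (1 + k) * L  ≡⟨ *-distribˡ-+ (1 + k) J L ⟨
      (1 + k) * (J + L) ∎
    c'≤ : (j + m) C j ≤ 2 * c
    c'≤ = C-double (q + 2) j j (≤-trans j²-bound (m≤m+n q 2))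
    -- The factor `suc j` comes from that ratio of binomials and `1 + k` from `G≤'`. Two of the
    -- factors k in `pairs` complete k⁴; the third is cancelled.
    [1+j][1+k]≤k² : suc j * (1 + k) ≤ k * k
    [1+j][1+k]≤k² = ≤-trans (m≤m+n _ (5 + j)) (≤-reflexive (lemma j))
      where
      lemma : ∀ j → suc j * (4 + j) + (5 + j) ≡ (3 + j) * (3 + j)
      lemma = solve-∀
    instance
      c≢0 : NonZero c
      c≢0 = >-nonZero (nCk>0 (q + 2) j)
      ck≢0 : NonZero (c * k)
      ck≢0 = m*n≢0 c k
    -- After multiplication by `c * k`, the identity (q + 2) c = (j + 1) C(m,j+1) makes the left
    -- side of `pairs` appear.
    cancelled : M * (q + 2) ≤ 2 * k ^ 4 * (J + L)
    cancelled = *-cancelʳ-≤ _ _ (c * k) (begin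
      M * (q + 2) * (c * k)                      ≡⟨ e₃ M (q + 2) c k ⟩
      M * k * ((q + 2) * c)                      ≡⟨ cong (M * k *_) ([k+1]*nC[k+1]≡[n∸k]*nCk (q + 2) j) ⟨
      M * k * (suc j * (m C suc j))              ≡⟨ e₄ M k (suc j) (m C suc j) ⟩
      suc j * (M * (k * (m C suc j)))            ≤⟨ *-monoʳ-≤ (suc j) pairs ⟩
      suc j * (G * (k * (k * (k * ((j + m) C j)))))
        ≤⟨ *-monoʳ-≤ (suc j) (*-mono-≤ G≤' (*-monoʳ-≤ k (*-monoʳ-≤ k (*-monoʳ-≤ k c'≤)))) ⟩
      suc j * ((1 + k) * (J + L) * (k * (k * (k * (2 * c))))) ≡⟨ e₅ (suc j) (1 + k) (J + L) k c ⟩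
      suc j * (1 + k) * ((J + L) * (k * (k * (k * (2 * c))))) ≤⟨ *-monoˡ-≤ ((J + L) * (k * (k * (k * (2 * c))))) [1+j][1+k]≤k² ⟩
      k * k * ((J + L) * (k * (k * (k * (2 * c)))))          ≡⟨ e₆ k (J + L) c ⟩
      2 * k ^ 4 * (J + L) * (c * k) ∎)
      where
      e₃ : ∀ M q c k → M * q * (c * k) ≡ M * k * (q * c)
      e₃ = solve-∀
      e₄ : ∀ M k i x → M * k * (i * x) ≡ i * (M * (k * x))
      e₄ = solve-∀
      e₅ : ∀ i a b k c → i * (a * b * (k * (k * (k * (2 * c))))) ≡ i * a * (b * (k * (k * (k * (2 * c)))))
      e₅ = solve-∀
      e₆ : ∀ k b c → k * k * (b * (k * (k * (k * (2 * c))))) ≡ 2 * (k * (k * (k * (k * 1)))) * b * (c * k)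
      e₆ = solve-∀

-- In the notation of the outline N = `suc m`, k = `suc κ`, and `I` counts the private sets.
-- Replacing I by f + J - M turns the weighted count into n f ≤ N C(n,κ), up to terms that
-- `exceptional` absorbs. Two absorption identities rewrite the right side as n C(n-1,κ), and n
-- cancels.
size-bound : ∀ κ m q f I J L M →
  suc κ * f + m * I + q * L ≤ suc m * ((suc m + κ) C κ) →
  I + M ≡ f + J → m * M ≤ m * J + q * L → f ≤ (m + κ) C κ
size-bound κ m q f I J L M counted I+M≡f+J exceptional = *-cancelˡ-≤ (suc (m + κ)) (+-cancelʳ-≤ (m * J + q * L) _ _ (begin
  suc (m + κ) * f + (m * J + q * L)           ≡⟨ e₁ m κ f J q L ⟩
  suc κ * f + m * (f + J) + q * L             ≡⟨ cong (λ z → suc κ * f + m * z + q * L) I+M≡f+J ⟨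
  suc κ * f + m * (I + M) + q * L             ≡⟨ e₂ (suc κ * f) m I M (q * L) ⟩
  suc κ * f + m * I + q * L + m * M           ≤⟨ +-mono-≤ counted exceptional ⟩
  suc m * ((suc m + κ) C κ) + (m * J + q * L) ≡⟨ cong (_+ (m * J + q * L)) ([k+1]*nC[k+1]≡[n∸k]*nCk (suc m) κ) ⟨
  suc κ * (suc (m + κ) C suc κ) + (m * J + q * L) ≡⟨ cong (_+ (m * J + q * L)) (k*nCk≡n*[n-1]C[k-1] (m + κ) κ) ⟩
  suc (m + κ) * ((m + κ) C κ) + (m * J + q * L) ∎))
  where
  open ≤-Reasoning
  e₁ : ∀ m κ f J q L → suc (m + κ) * f + (m * J + q * L) ≡ suc κ * f + m * (f + J) + q * L
  e₁ = solve-∀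
  e₂ : ∀ a m I M b → a + m * (I + M) + b ≡ a + m * I + b + m * M
  e₂ = solve-∀

-- The constant 5 + 2j is 2k - 1.
n-decomposition : ∀ j n → 3 * (3 + j) ^ 5 ≤ n → 4 * (3 + j) ^ 4 + (5 + 2 * j) ≤ n
n-decomposition j n = ≤-trans (begin
  4 * k ^ 4 + (5 + 2 * j)     ≤⟨ +-monoʳ-≤ (4 * k ^ 4) (≤-trans (m≤m+n _ 1) (≤-reflexive (e₁ j))) ⟩
  4 * k ^ 4 + 2 * k           ≤⟨ +-monoʳ-≤ (4 * k ^ 4) (*-mono-≤ {2} {5} (s≤s (s≤s z≤n)) (m≤m*n k (k ^ 3) ⦃ m^n≢0 k 3 ⦄)) ⟩
  4 * k ^ 4 + 5 * k ^ 4       ≡⟨ e₂ (k ^ 4) ⟩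
  3 * (3 * k ^ 4)             ≤⟨ *-monoʳ-≤ 3 (*-monoˡ-≤ (k ^ 4) (m≤m+n 3 j)) ⟩
  3 * k ^ 5 ∎)
  where
  open ≤-Reasoning
  k = 3 + j
  e₁ : ∀ j → 5 + 2 * j + 1 ≡ 2 * (3 + j)
  e₁ = solve-∀
  e₂ : ∀ x → 4 * x + 5 * x ≡ 3 * (3 * x)
  e₂ = solve-∀

-- Counting in lists

private variable
  X Y : Set
  P Q : Set

-- The Iverson bracket; cardinalities become sums of brackets, so double counting is an exchange of
-- sums.
⟦_⟧ : Dec P → ℕ
⟦ yes _ ⟧ = 1
⟦ no _ ⟧ = 0

⟦⟧-mono : (p : Dec P) (q : Dec Q) → (P → Q) → ⟦ p ⟧ ≤ ⟦ q ⟧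
⟦⟧-mono (no _) q f = z≤n
⟦⟧-mono (yes p) (yes q) f = ≤-refl
⟦⟧-mono (yes p) (no ¬q) f = contradiction (f p) ¬q

⟦⟧-cong : (p : Dec P) (q : Dec Q) → (P → Q) → (Q → P) → ⟦ p ⟧ ≡ ⟦ q ⟧
⟦⟧-cong p q f g = ≤-antisym (⟦⟧-mono p q f) (⟦⟧-mono q p g)

⟦⟧-yes : (p : Dec P) → P → ⟦ p ⟧ ≡ 1
⟦⟧-yes (yes _) p = refl
⟦⟧-yes (no ¬p) p = contradiction p ¬p

⟦⟧-no : (p : Dec P) → ¬ P → ⟦ p ⟧ ≡ 0
⟦⟧-no (yes p) ¬p = contradiction p ¬p
⟦⟧-no (no _) _ = refl

⟦⟧-× : (p : Dec P) (q : Dec Q) → ⟦ p ×-dec q ⟧ ≡ ⟦ q ⟧ * ⟦ p ⟧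
⟦⟧-× (yes _) (yes _) = refl
⟦⟧-× (yes _) (no _) = refl
⟦⟧-× (no _) (yes _) = refl
⟦⟧-× (no _) (no _) = refl

⟦⟧-split : (p : Dec P) (q : Dec Q) → ⟦ p ⟧ ≡ ⟦ p ×-dec q ⟧ + ⟦ p ×-dec ¬? q ⟧
⟦⟧-split (yes _) (yes _) = refl
⟦⟧-split (yes _) (no _) = refl
⟦⟧-split (no _) q = refl

∑ : List X → (X → ℕ) → ℕ
∑ xs f = sum (map f xs)

∑-mono : ∀ (xs : List X) {f g : X → ℕ} → (∀ {x} → x L.∈ xs → f x ≤ g x) → ∑ xs f ≤ ∑ xs g
∑-mono [] f≤g = z≤n
∑-mono (x ∷ xs) f≤g = +-mono-≤ (f≤g (here refl)) (∑-mono xs (f≤g ∘ there))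

∑-cong : ∀ (xs : List X) {f g : X → ℕ} → (∀ {x} → x L.∈ xs → f x ≡ g x) → ∑ xs f ≡ ∑ xs g
∑-cong xs f≡g = ≤-antisym (∑-mono xs (≤-reflexive ∘ f≡g)) (∑-mono xs (≤-reflexive ∘ sym ∘ f≡g))

+-interchange : ∀ a b c d → (a + b) + (c + d) ≡ (a + c) + (b + d)
+-interchange = solve-∀

∑-+ : ∀ (xs : List X) (f g : X → ℕ) → ∑ xs (λ x → f x + g x) ≡ ∑ xs f + ∑ xs g
∑-+ [] f g = refl
∑-+ (x ∷ xs) f g = trans (cong (f x + g x +_) (∑-+ xs f g)) (+-interchange (f x) (g x) _ _)

∑-*ˡ : ∀ (xs : List X) c (f : X → ℕ) → ∑ xs (λ x → c * f x) ≡ c * ∑ xs f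
∑-*ˡ [] c f = sym (*-zeroʳ c)
∑-*ˡ (x ∷ xs) c f = trans (cong (c * f x +_) (∑-*ˡ xs c f)) (sym (*-distribˡ-+ c (f x) _))

∑-const : ∀ (xs : List X) c → ∑ xs (λ _ → c) ≡ length xs * c
∑-const [] c = refl
∑-const (x ∷ xs) c = cong (c +_) (∑-const xs c)

∑-≤ : ∀ (xs : List X) {f : X → ℕ} {c} → (∀ {x} → x L.∈ xs → f x ≤ c) → ∑ xs f ≤ length xs * c
∑-≤ xs {c = c} f≤c = subst (_ ≤_) (∑-const xs c) (∑-mono xs f≤c)

∑-swap : ∀ (xs : List X) (ys : List Y) (f : X → Y → ℕ) →
  ∑ xs (λ x → ∑ ys (f x)) ≡ ∑ ys (λ y → ∑ xs (λ x → f x y))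
∑-swap [] ys f = sym (trans (∑-const ys 0) (*-zeroʳ (length ys)))
∑-swap (x ∷ xs) ys f = trans (cong (∑ ys (f x) +_) (∑-swap xs ys f)) (sym (∑-+ ys (f x) _))

∑-++ : ∀ (xs ys : List X) (f : X → ℕ) → ∑ (xs ++ ys) f ≡ ∑ xs f + ∑ ys f
∑-++ xs ys f = trans (cong sum (map-++ f xs ys)) (sum-++ (map f xs) _)

∑-map : ∀ (xs : List X) (g : X → Y) (f : Y → ℕ) → ∑ (map g xs) f ≡ ∑ xs (f ∘ g)
∑-map xs g f = cong sum (sym (map-∘ xs))

∑-∈ : ∀ {xs : List X} (f : X → ℕ) {x} → x L.∈ xs → f x ≤ ∑ xs f
∑-∈ f (here refl) = m≤m+n _ _
∑-∈ f (there x∈) = ≤-trans (∑-∈ f x∈) (m≤n+m _ _)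

∑-∈₂ : ∀ {xs : List X} (f : X → ℕ) {x y} → x L.∈ xs → y L.∈ xs → x ≢ y → f x + f y ≤ ∑ xs f
∑-∈₂ f (here refl) (here refl) x≢y = contradiction refl x≢y
∑-∈₂ f (here refl) (there y∈) x≢y = +-monoʳ-≤ _ (∑-∈ f y∈)
∑-∈₂ f {x} {y} (there x∈) (here refl) x≢y =
  ≤-trans (≤-reflexive (+-comm (f x) (f y))) (+-monoʳ-≤ (f y) (∑-∈ f x∈))
∑-∈₂ f (there x∈) (there y∈) x≢y = ≤-trans (∑-∈₂ f x∈ y∈ x≢y) (m≤n+m _ _)

∑-witness : ∀ (xs : List X) (f : X → ℕ) → 1 ≤ ∑ xs f → ∃[ x ] (x L.∈ xs × 1 ≤ f x)
∑-witness (x ∷ xs) f 1≤ with f x in eq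
... | suc m = x , here refl , subst (1 ≤_) (sym eq) (s≤s z≤n)
... | zero with ∑-witness xs f 1≤
...   | y , y∈ , 1≤fy = y , there y∈ , 1≤fy

# : {P : Pred X 0ℓ} → Decidable P → List X → ℕ
# P? xs = ∑ xs (λ x → ⟦ P? x ⟧)

module _ {P : Pred X 0ℓ} (P? : Decidable P) where

  #-witness : ∀ xs → 1 ≤ # P? xs → ∃[ x ] (x L.∈ xs × P x)
  #-witness xs 1≤ with ∑-witness xs _ 1≤
  ... | x , x∈ , 1≤Px with P? x
  ...   | yes Px = x , x∈ , Px

  #-∈ : ∀ {xs x} → x L.∈ xs → P x → 1 ≤ # P? xs
  #-∈ {x = x} x∈ Px = ≤-trans (≤-reflexive (sym (⟦⟧-yes (P? x) Px))) (∑-∈ _ x∈)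

  #-∈₂ : ∀ {xs x y} → x L.∈ xs → P x → y L.∈ xs → P y → x ≢ y → 2 ≤ # P? xs
  #-∈₂ {x = x} {y} x∈ Px y∈ Py x≢y = ≤-trans
    (≤-reflexive (sym (cong₂ _+_ (⟦⟧-yes (P? x) Px) (⟦⟧-yes (P? y) Py)))) (∑-∈₂ _ x∈ y∈ x≢y)

  #-none : ∀ xs → (∀ {x} → x L.∈ xs → ¬ P x) → # P? xs ≡ 0
  #-none xs ¬P = trans (∑-cong xs (λ x∈ → ⟦⟧-no (P? _) (¬P x∈))) (trans (∑-const xs 0) (*-zeroʳ (length xs)))

  ∑-filter : ∀ xs (f : X → ℕ) → ∑ (filter P? xs) f ≡ ∑ xs (λ x → ⟦ P? x ⟧ * f x)
  ∑-filter [] f = refl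
  ∑-filter (x ∷ xs) f with P? x
  ... | yes _ = cong₂ _+_ (sym (+-identityʳ (f x))) (∑-filter xs f)
  ... | no _ = ∑-filter xs f

  length-filter≡# : ∀ xs → length (filter P? xs) ≡ # P? xs
  length-filter≡# [] = refl
  length-filter≡# (x ∷ xs) with P? x
  ... | yes _ = cong suc (length-filter≡# xs)
  ... | no _ = length-filter≡# xs

#-mono : {P Q : Pred X 0ℓ} (P? : Decidable P) (Q? : Decidable Q) (xs : List X) →
  (∀ {x} → x L.∈ xs → P x → Q x) → # P? xs ≤ # Q? xs
#-mono P? Q? xs P⇒Q = ∑-mono xs (λ x∈ → ⟦⟧-mono (P? _) (Q? _) (P⇒Q x∈))

-- The union bound: an entry satisfying P contributes at least 1 to the double sum, which is then
-- summed in the other order.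
#-cover : {P : Pred X 0ℓ} (P? : Decidable P) {Q : Y → Pred X 0ℓ} (Q? : ∀ y → Decidable (Q y))
  (xs : List X) (ys : List Y) {c : ℕ} →
  (∀ {x} → x L.∈ xs → P x → ∃[ y ] (y L.∈ ys × Q y x)) →
  (∀ {y} → y L.∈ ys → # (Q? y) xs ≤ c) →
  # P? xs ≤ length ys * c
#-cover P? Q? xs ys {c} cover bound = begin
  ∑ xs (λ x → ⟦ P? x ⟧)                ≤⟨ ∑-mono xs pointwise ⟩
  ∑ xs (λ x → ∑ ys (λ y → ⟦ Q? y x ⟧)) ≡⟨ ∑-swap xs ys _ ⟩
  ∑ ys (λ y → # (Q? y) xs)             ≤⟨ ∑-≤ ys bound ⟩
  length ys * c ∎
  where
  open ≤-Reasoning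
  pointwise : ∀ {x} → x L.∈ xs → ⟦ P? x ⟧ ≤ ∑ ys (λ y → ⟦ Q? y x ⟧)
  pointwise {x} x∈ with P? x
  ... | no _ = z≤n
  ... | yes Px with cover x∈ Px
  ...   | y , y∈ , Qyx = #-∈ (λ y → Q? y x) y∈ Qyx

module _ (_≟X_ : DecidableEquality X) where

  #-unique : ∀ {xs} → Unique xs → ∀ y → # (_≟X y) xs ≤ 1
  #-unique AllPairs.[] y = z≤n
  #-unique {x ∷ xs} (x∉ AllPairs.∷ u) y with x ≟X y
  ... | no _ = #-unique u y
  ... | yes refl = ≤-reflexive (cong suc (#-none (_≟X x) xs (λ z∈ z≡x → All.lookup x∉ z∈ (sym z≡x))))

  -- Double counting of the pairs x ≡ y with Q y: each x satisfying P starts such a pair, and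
  -- uniqueness of `xs` lets each y end at most one.
  #-⊆ : {P Q : Pred X 0ℓ} (P? : Decidable P) (Q? : Decidable Q) {xs ys : List X} → Unique xs →
    (∀ {x} → x L.∈ xs → P x → x L.∈ ys × Q x) → # P? xs ≤ # Q? ys
  #-⊆ P? Q? {xs} {ys} u sub = begin
    ∑ xs (λ x → ⟦ P? x ⟧)                             ≤⟨ ∑-mono xs pointwise ⟩
    ∑ xs (λ x → ∑ ys (λ y → ⟦ (x ≟X y) ×-dec Q? y ⟧)) ≡⟨ ∑-swap xs ys _ ⟩
    ∑ ys (λ y → ∑ xs (λ x → ⟦ (x ≟X y) ×-dec Q? y ⟧)) ≤⟨ ∑-mono ys (λ {y} _ → collapse y) ⟩
    ∑ ys (λ y → ⟦ Q? y ⟧) ∎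
    where
    open ≤-Reasoning
    pointwise : ∀ {x} → x L.∈ xs → ⟦ P? x ⟧ ≤ ∑ ys (λ y → ⟦ (x ≟X y) ×-dec Q? y ⟧)
    pointwise {x} x∈ with P? x
    ... | no _ = z≤n
    ... | yes Px with sub x∈ Px
    ...   | x∈ys , Qx = #-∈ (λ y → (x ≟X y) ×-dec Q? y) x∈ys (refl , Qx)
    collapse : ∀ y → ∑ xs (λ x → ⟦ (x ≟X y) ×-dec Q? y ⟧) ≤ ⟦ Q? y ⟧
    collapse y = begin
      ∑ xs (λ x → ⟦ (x ≟X y) ×-dec Q? y ⟧)   ≡⟨ ∑-cong xs (λ _ → ⟦⟧-× (_ ≟X y) (Q? y)) ⟩
      ∑ xs (λ x → ⟦ Q? y ⟧ * ⟦ x ≟X y ⟧)     ≡⟨ ∑-*ˡ xs ⟦ Q? y ⟧ (λ x → ⟦ x ≟X y ⟧) ⟩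
      ⟦ Q? y ⟧ * # (_≟X y) xs                ≤⟨ *-monoʳ-≤ ⟦ Q? y ⟧ (#-unique u y) ⟩
      ⟦ Q? y ⟧ * 1                           ≡⟨ *-identityʳ _ ⟩
      ⟦ Q? y ⟧ ∎

  -- The count splits into y ≡ x and y ≢ x. Uniqueness bounds the first part by 1, so an empty
  -- second part would make the count exactly 1.
  #-another : {P : Pred X 0ℓ} (P? : Decidable P) {xs : List X} → Unique xs →
    ∀ {x} → x L.∈ xs → P x → # P? xs ≢ 1 → ∃[ y ] (y L.∈ xs × P y × y ≢ x)
  #-another P? {xs} u {x} x∈ Px #≢1 with 1 ≤? # (λ y → P? y ×-dec ¬? (y ≟X x)) xs
  ... | yes 1≤ = #-witness _ xs 1≤
  ... | no 1≰ = contradiction (≤-antisym #≤1 (#-∈ P? x∈ Px)) #≢1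
    where
    open ≤-Reasoning
    #≤1 : # P? xs ≤ 1
    #≤1 = begin
      # P? xs ≡⟨ ∑-cong xs (λ {y} _ → ⟦⟧-split (P? y) (y ≟X x)) ⟩
      ∑ xs (λ y → ⟦ P? y ×-dec (y ≟X x) ⟧ + ⟦ P? y ×-dec ¬? (y ≟X x) ⟧) ≡⟨ ∑-+ xs _ _ ⟩
      # (λ y → P? y ×-dec (y ≟X x)) xs + # (λ y → P? y ×-dec ¬? (y ≟X x)) xs
        ≤⟨ +-mono-≤ (#-mono _ (_≟X x) xs (λ _ → proj₂)) (≤-reflexive (n<1⇒n≡0 (≰⇒> 1≰))) ⟩
      # (_≟X x) xs + 0 ≡⟨ +-identityʳ _ ⟩
      # (_≟X x) xs ≤⟨ #-unique u x ⟩
      1 ∎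

-- Finite subsets

private variable
  n : ℕ
  p q : Subset n
  x y : Fin n

_≟ˢ_ : DecidableEquality (Subset n)
_≟ˢ_ = ≡-dec _≟ᵇ_

subsets : ∀ n → List (Subset n)
subsets zero = [] ∷ []
subsets (suc n) = map (outside ∷_) (subsets n) ++ map (inside ∷_) (subsets n)

∈-subsets : (p : Subset n) → p L.∈ subsets n
∈-subsets [] = here refl
∈-subsets (outside ∷ p) = ∈-++⁺ˡ (∈-map⁺ (outside ∷_) (∈-subsets p))
∈-subsets {suc n} (inside ∷ p) = ∈-++⁺ʳ (map (outside ∷_) (subsets n)) (∈-map⁺ (inside ∷_) (∈-subsets p))

#-cong : {X : Set} {P Q : Pred X 0ℓ} (P? : Decidable P) (Q? : Decidable Q) (xs : List X) →
  (∀ {x} → P x → Q x) → (∀ {x} → Q x → P x) → # P? xs ≡ # Q? xs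
#-cong P? Q? xs f g = ∑-cong xs (λ _ → ⟦⟧-cong (P? _) (Q? _) f g)

#-subsets-suc : {P : Pred (Subset (suc n)) 0ℓ} (P? : Decidable P) →
  # P? (subsets (suc n)) ≡ # (P? ∘ (outside ∷_)) (subsets n) + # (P? ∘ (inside ∷_)) (subsets n)
#-subsets-suc {n} P? = trans (∑-++ (map (outside ∷_) (subsets n)) (map (inside ∷_) (subsets n)) _)
  (cong₂ _+_ (∑-map (subsets n) (outside ∷_) _) (∑-map (subsets n) (inside ∷_) _))

-- One count by profile serves all later ones: all sets of a given size, the facets of a member, the
-- sets containing `p`, and the sets meeting a full set in one point.
Profile : Subset n → ℕ → ℕ → Pred (Subset n) 0ℓ
Profile p i j q = ∣ q ∩ p ∣ ≡ i × ∣ q ∩ ∁ p ∣ ≡ j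

profile? : (p : Subset n) (i j : ℕ) → Decidable (Profile p i j)
profile? p i j q = (∣ q ∩ p ∣ ≟ i) ×-dec (∣ q ∩ ∁ p ∣ ≟ j)

-- The choices inside and outside `p` are independent. The induction removes the first point and
-- applies Pascal's rule to the factor of the side on which it lies.
#-profile : ∀ (p : Subset n) i j → # (profile? p i j) (subsets n) ≡ (∣ p ∣ C i) * (∣ ∁ p ∣ C j)
#-profile [] zero zero = refl
#-profile [] zero (suc j) = sym (trans (cong (1 *_) (k>n⇒nCk≡0 {0} {suc j} (s≤s z≤n))) refl)
#-profile [] (suc i) j = sym (cong (_* (0 C j)) (k>n⇒nCk≡0 {0} {suc i} (s≤s z≤n)))
#-profile {suc n} (outside ∷ p) i zero = begin
  # (profile? (outside ∷ p) i 0) (subsets (suc n)) ≡⟨ #-subsets-suc (profile? (outside ∷ p) i 0) ⟩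
  # (profile? p i 0) (subsets n) + # (profile? (outside ∷ p) i 0 ∘ (inside ∷_)) (subsets n)
    ≡⟨ cong₂ _+_ (#-profile p i 0) (#-none (profile? (outside ∷ p) i 0 ∘ (inside ∷_)) (subsets n) λ { _ (_ , ()) }) ⟩
  (∣ p ∣ C i) * (∣ ∁ p ∣ C 0) + 0 ≡⟨ +-identityʳ _ ⟩
  (∣ p ∣ C i) * 1 ∎
  where open ≡-Reasoning
#-profile {suc n} (outside ∷ p) i (suc j) = begin
  # (profile? (outside ∷ p) i (suc j)) (subsets (suc n)) ≡⟨ #-subsets-suc (profile? (outside ∷ p) i (suc j)) ⟩
  # (profile? p i (suc j)) (subsets n) + # (profile? (outside ∷ p) i (suc j) ∘ (inside ∷_)) (subsets n)
    ≡⟨ cong₂ _+_ (#-profile p i (suc j))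
        (trans (#-cong (profile? (outside ∷ p) i (suc j) ∘ (inside ∷_)) (profile? p i j) (subsets n) (map₂ suc-injective) (map₂ (cong suc))) (#-profile p i j)) ⟩
  (∣ p ∣ C i) * (∣ ∁ p ∣ C suc j) + (∣ p ∣ C i) * (∣ ∁ p ∣ C j) ≡⟨ *-distribˡ-+ (∣ p ∣ C i) _ _ ⟨
  (∣ p ∣ C i) * ((∣ ∁ p ∣ C suc j) + (∣ ∁ p ∣ C j)) ≡⟨ cong ((∣ p ∣ C i) *_) (+-comm (∣ ∁ p ∣ C suc j) _) ⟩
  (∣ p ∣ C i) * ((∣ ∁ p ∣ C j) + (∣ ∁ p ∣ C suc j))
    ≡⟨ cong ((∣ p ∣ C i) *_) (nCk+nC[k+1]≡[n+1]C[k+1] ∣ ∁ p ∣ j) ⟩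
  (∣ p ∣ C i) * (suc ∣ ∁ p ∣ C suc j) ∎
  where open ≡-Reasoning
#-profile {suc n} (inside ∷ p) zero j = begin
  # (profile? (inside ∷ p) 0 j) (subsets (suc n)) ≡⟨ #-subsets-suc (profile? (inside ∷ p) 0 j) ⟩
  # (profile? p 0 j) (subsets n) + # (profile? (inside ∷ p) 0 j ∘ (inside ∷_)) (subsets n)
    ≡⟨ cong₂ _+_ (#-profile p 0 j) (#-none (profile? (inside ∷ p) 0 j ∘ (inside ∷_)) (subsets n) λ { _ (() , _) }) ⟩
  1 * (∣ ∁ p ∣ C j) + 0 ≡⟨ +-identityʳ _ ⟩
  1 * (∣ ∁ p ∣ C j) ∎
  where open ≡-Reasoning
#-profile {suc n} (inside ∷ p) (suc i) j = begin
  # (profile? (inside ∷ p) (suc i) j) (subsets (suc n)) ≡⟨ #-subsets-suc (profile? (inside ∷ p) (suc i) j) ⟩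
  # (profile? p (suc i) j) (subsets n) + # (profile? (inside ∷ p) (suc i) j ∘ (inside ∷_)) (subsets n)
    ≡⟨ cong₂ _+_ (#-profile p (suc i) j)
        (trans (#-cong (profile? (inside ∷ p) (suc i) j ∘ (inside ∷_)) (profile? p i j) (subsets n) (map₁ suc-injective) (map₁ (cong suc))) (#-profile p i j)) ⟩
  (∣ p ∣ C suc i) * (∣ ∁ p ∣ C j) + (∣ p ∣ C i) * (∣ ∁ p ∣ C j) ≡⟨ *-distribʳ-+ (∣ ∁ p ∣ C j) (∣ p ∣ C suc i) _ ⟨
  ((∣ p ∣ C suc i) + (∣ p ∣ C i)) * (∣ ∁ p ∣ C j) ≡⟨ cong (_* (∣ ∁ p ∣ C j)) (+-comm (∣ p ∣ C suc i) _) ⟩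
  ((∣ p ∣ C i) + (∣ p ∣ C suc i)) * (∣ ∁ p ∣ C j)
    ≡⟨ cong (_* (∣ ∁ p ∣ C j)) (nCk+nC[k+1]≡[n+1]C[k+1] ∣ p ∣ i) ⟩
  (suc ∣ p ∣ C suc i) * (∣ ∁ p ∣ C j) ∎
  where open ≡-Reasoning

∣p∣≡∣p∩q∣+∣p∩∁q∣ : ∀ (p q : Subset n) → ∣ p ∣ ≡ ∣ p ∩ q ∣ + ∣ p ∩ ∁ q ∣
∣p∣≡∣p∩q∣+∣p∩∁q∣ [] [] = refl
∣p∣≡∣p∩q∣+∣p∩∁q∣ (outside ∷ p) (_ ∷ q) = ∣p∣≡∣p∩q∣+∣p∩∁q∣ p q
∣p∣≡∣p∩q∣+∣p∩∁q∣ (inside ∷ p) (inside ∷ q) = cong suc (∣p∣≡∣p∩q∣+∣p∩∁q∣ p q)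
∣p∣≡∣p∩q∣+∣p∩∁q∣ (inside ∷ p) (outside ∷ q) =
  trans (cong suc (∣p∣≡∣p∩q∣+∣p∩∁q∣ p q)) (sym (+-suc ∣ p ∩ q ∣ _))

∣p∪q∣≤∣p∣+∣q∩∁p∣ : ∀ (p q : Subset n) → ∣ p ∪ q ∣ ≤ ∣ p ∣ + ∣ q ∩ ∁ p ∣
∣p∪q∣≤∣p∣+∣q∩∁p∣ [] [] = z≤n
∣p∪q∣≤∣p∣+∣q∩∁p∣ (inside ∷ p) (s ∷ q) with s
... | inside = s≤s (∣p∪q∣≤∣p∣+∣q∩∁p∣ p q)
... | outside = s≤s (∣p∪q∣≤∣p∣+∣q∩∁p∣ p q)
∣p∪q∣≤∣p∣+∣q∩∁p∣ (outside ∷ p) (outside ∷ q) = ∣p∪q∣≤∣p∣+∣q∩∁p∣ p q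
∣p∪q∣≤∣p∣+∣q∩∁p∣ (outside ∷ p) (inside ∷ q) =
  ≤-trans (s≤s (∣p∪q∣≤∣p∣+∣q∩∁p∣ p q)) (≤-reflexive (sym (+-suc ∣ p ∣ _)))

p⊆q⇒p∩q≡p : p ⊆ q → p ∩ q ≡ p
p⊆q⇒p∩q≡p {p = p} {q} p⊆q = ⊆-antisym (p∩q⊆p p q) (λ x∈p → x∈p∩q⁺ (x∈p , p⊆q x∈p))

p⊆q⇒q∩p≡p : p ⊆ q → q ∩ p ≡ p
p⊆q⇒q∩p≡p {p = p} {q} p⊆q = ⊆-antisym (p∩q⊆q q p) (λ x∈p → x∈p∩q⁺ (p⊆q x∈p , x∈p))

p⊆q∧∣q∣≤∣p∣⇒p≡q : p ⊆ q → ∣ q ∣ ≤ ∣ p ∣ → p ≡ q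
p⊆q∧∣q∣≤∣p∣⇒p≡q {p = p} {q} p⊆q ∣q∣≤∣p∣ with Fin.any? (λ x → (x ∈? q) ×-dec ¬? (x ∈? p))
... | yes (x , x∈q , x∉p) = contradiction ∣q∣≤∣p∣ (<⇒≱ (p⊂q⇒∣p∣<∣q∣ (p⊆q , x , x∈q , x∉p)))
... | no ∄ = ⊆-antisym p⊆q q⊆p
  where
  q⊆p : q ⊆ p
  q⊆p {x} x∈q with x ∈? p
  ... | yes x∈p = x∈p
  ... | no x∉p = contradiction (x , x∈q , x∉p) ∄

1≤∣p∣⇒Nonempty : 1 ≤ ∣ p ∣ → Nonempty p
1≤∣p∣⇒Nonempty {n} {p} 1≤ with nonempty? p
... | yes ne = ne
... | no ∄ = contradiction (subst (1 ≤_) (trans (cong ∣_∣ (Empty-unique ∄)) (∣⊥∣≡0 n)) 1≤) λ ()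

x∈p⇒1≤∣p∣ : x ∈ p → 1 ≤ ∣ p ∣
x∈p⇒1≤∣p∣ {x = x} {p} x∈p = subst (_≤ ∣ p ∣) (∣⁅x⁆∣≡1 x)
  (p⊆q⇒∣p∣≤∣q∣ (λ y∈ → subst (_∈ p) (sym (x∈⁅y⁆⇒x≡y x y∈)) x∈p))

p∩⁅x⁆≡⁅x⁆ : x ∈ p → p ∩ ⁅ x ⁆ ≡ ⁅ x ⁆
p∩⁅x⁆≡⁅x⁆ {x = x} {p} x∈p = p⊆q⇒q∩p≡p (λ y∈ → subst (_∈ p) (sym (x∈⁅y⁆⇒x≡y x y∈)) x∈p)

p─q≡p∩∁q : ∀ (p q : Subset n) → p ─ q ≡ p ∩ ∁ q
p─q≡p∩∁q [] [] = refl
p─q≡p∩∁q (inside ∷ p) (inside ∷ q) = cong (outside ∷_) (p─q≡p∩∁q p q)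
p─q≡p∩∁q (inside ∷ p) (outside ∷ q) = cong (inside ∷_) (p─q≡p∩∁q p q)
p─q≡p∩∁q (outside ∷ p) (inside ∷ q) = cong (outside ∷_) (p─q≡p∩∁q p q)
p─q≡p∩∁q (outside ∷ p) (outside ∷ q) = cong (outside ∷_) (p─q≡p∩∁q p q)

∣p∣≡1+∣p-x∣ : x ∈ p → ∣ p ∣ ≡ suc ∣ p - x ∣
∣p∣≡1+∣p-x∣ {x = x} {p} x∈p = begin
  ∣ p ∣                             ≡⟨ ∣p∣≡∣p∩q∣+∣p∩∁q∣ p ⁅ x ⁆ ⟩
  ∣ p ∩ ⁅ x ⁆ ∣ + ∣ p ∩ ∁ ⁅ x ⁆ ∣   ≡⟨ cong₂ _+_ (trans (cong ∣_∣ (p∩⁅x⁆≡⁅x⁆ x∈p)) (∣⁅x⁆∣≡1 x)) (cong ∣_∣ (sym (p─q≡p∩∁q p ⁅ x ⁆))) ⟩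
  suc ∣ p - x ∣                     ∎
  where open ≡-Reasoning

x∉p-x : x ∉ p - x
x∉p-x {x = x} {p} x∈ = x∈∁p⇒x∉p (proj₂ (x∈p∩q⁻ p (∁ ⁅ x ⁆) (subst (x ∈_) (p─q≡p∩∁q p ⁅ x ⁆) x∈))) (x∈⁅x⁆ x)

x∈p-y⇒x∈p : x ∈ p - y → x ∈ p
x∈p-y⇒x∈p {p = p} {y} = p─q⊆p p ⁅ y ⁆

x∈p∪⁅x⁆ : x ∈ p ∪ ⁅ x ⁆
x∈p∪⁅x⁆ {x = x} {p} = q⊆p∪q p ⁅ x ⁆ (x∈⁅x⁆ x)

∣p∪⁅x⁆∣≡1+∣p∣ : x ∉ p → ∣ p ∪ ⁅ x ⁆ ∣ ≡ suc ∣ p ∣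
∣p∪⁅x⁆∣≡1+∣p∣ {x = x} {p} x∉p = trans (∣p∣≡1+∣p-x∣ (x∈p∪⁅x⁆ {p = p})) (cong (suc ∘ ∣_∣) (⊆-antisym ⊆p p⊆))
  where
  ⊆p : (p ∪ ⁅ x ⁆) - x ⊆ p
  ⊆p {y} y∈ with x∈p∪q⁻ p ⁅ x ⁆ (x∈p-y⇒x∈p {p = p ∪ ⁅ x ⁆} y∈)
  ... | inj₁ y∈p = y∈p
  ... | inj₂ y∈x = contradiction (subst (_∈ (p ∪ ⁅ x ⁆) - x) (x∈⁅y⁆⇒x≡y x y∈x) y∈) (x∉p-x {p = p ∪ ⁅ x ⁆})
  p⊆ : p ⊆ (p ∪ ⁅ x ⁆) - x
  p⊆ y∈p = x∈p∧x≢y⇒x∈p-y (p⊆p∪q ⁅ x ⁆ y∈p) (λ y≡x → x∉p (subst (_∈ p) y≡x y∈p))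

p∪⁅x⁆⊆q : p ⊆ q → x ∈ q → p ∪ ⁅ x ⁆ ⊆ q
p∪⁅x⁆⊆q {p = p} {q} {x} p⊆q x∈q y∈ with x∈p∪q⁻ p ⁅ x ⁆ y∈
... | inj₁ y∈p = p⊆q y∈p
... | inj₂ y∈x = subst (_∈ q) (sym (x∈⁅y⁆⇒x≡y x y∈x)) x∈q

x∈p∧∣p∣≢1⇒another : x ∈ p → ∣ p ∣ ≢ 1 → ∃[ y ] (y ∈ p × y ≢ x)
x∈p∧∣p∣≢1⇒another {x = x} {p} x∈p ∣p∣≢1 with ∣ p - x ∣ in eq
... | zero = contradiction (trans (∣p∣≡1+∣p-x∣ x∈p) (cong suc eq)) ∣p∣≢1
... | suc _ with 1≤∣p∣⇒Nonempty {p = p - x} (subst (1 ≤_) (sym eq) (s≤s z≤n))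
...   | y , y∈ = y , x∈p-y⇒x∈p {p = p} y∈ , λ { refl → x∉p-x {p = p} y∈ }

∣p∣≡1⇒≡ : ∣ p ∣ ≡ 1 → x ∈ p → y ∈ p → y ≡ x
∣p∣≡1⇒≡ {p = p} {x} {y} ∣p∣≡1 x∈p y∈p with y Fin.≟ x
... | yes y≡x = y≡x
... | no y≢x = contradiction
  (subst (1 ≤_) (suc-injective (trans (sym (∣p∣≡1+∣p-x∣ x∈p)) ∣p∣≡1)) (x∈p⇒1≤∣p∣ (x∈p∧x≢y⇒x∈p-y y∈p y≢x)))
  λ ()

elements : Subset n → List (Fin n)
elements p = filter (_∈? p) (allFin _)

∈-elements⁺ : x ∈ p → x L.∈ elements p
∈-elements⁺ {x = x} {p} x∈p = ∈-filter⁺ (_∈? p) (∈-allFin x) x∈p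

∈-elements⁻ : x L.∈ elements p → x ∈ p
∈-elements⁻ {p = p} x∈ = proj₂ (∈-filter⁻ (_∈? p) {xs = allFin _} x∈)

elements-unique : (p : Subset n) → Unique (elements p)
elements-unique {n} p = Unique.filter⁺ (_∈? p) (Unique.allFin⁺ n)

∑-allFin-suc : ∀ (f : Fin (suc n) → ℕ) → ∑ (allFin (suc n)) f ≡ f zero + ∑ (allFin n) (f ∘ suc)
∑-allFin-suc {n} f = cong (f zero +_)
  (trans (cong (λ xs → ∑ xs f) (sym (map-tabulate {n = n} id suc))) (∑-map (allFin n) suc f))

#-∈≡∣p∣ : (p : Subset n) → # (_∈? p) (allFin n) ≡ ∣ p ∣
#-∈≡∣p∣ [] = refl
#-∈≡∣p∣ {suc n} (s ∷ p) = trans (∑-allFin-suc (λ x → ⟦ x ∈? (s ∷ p) ⟧))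
  (trans (cong (⟦ zero ∈? (s ∷ p) ⟧ +_)
    (trans (#-cong _ (_∈? p) (allFin n) drop-there there) (#-∈≡∣p∣ p))) (head s))
  where
  head : ∀ s → ⟦ zero ∈? (s ∷ p) ⟧ + ∣ p ∣ ≡ ∣ s ∷ p ∣
  head inside = refl
  head outside = refl

length-elements : (p : Subset n) → length (elements p) ≡ ∣ p ∣
length-elements p = trans (length-filter≡# (_∈? p) (allFin _)) (#-∈≡∣p∣ p)

-- Sets containing p have profile (∣ p ∣ , r) with respect to p.
#-⊇≤C : ∀ {xs : List (Subset n)} (p : Subset n) r → Unique xs →
  (∀ {q} → q L.∈ xs → ∣ q ∣ ≡ ∣ p ∣ + r) → # (p ⊆?_) xs ≤ (n ∸ ∣ p ∣) C r
#-⊇≤C {n} {xs} p r u size = begin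
  # (p ⊆?_) xs                            ≤⟨ #-⊆ _≟ˢ_ (p ⊆?_) (profile? p ∣ p ∣ r) {ys = subsets n} u profile ⟩
  # (profile? p ∣ p ∣ r) (subsets n)      ≡⟨ #-profile p ∣ p ∣ r ⟩
  (∣ p ∣ C ∣ p ∣) * (∣ ∁ p ∣ C r)         ≡⟨ cong₂ (λ a b → a * (b C r)) (nCn≡1 ∣ p ∣) (∣∁p∣≡n∸∣p∣ p) ⟩
  1 * ((n ∸ ∣ p ∣) C r)                   ≡⟨ *-identityˡ _ ⟩
  (n ∸ ∣ p ∣) C r                         ∎
  where
  open ≤-Reasoning
  profile : ∀ {q} → q L.∈ xs → p ⊆ q → q L.∈ subsets n × Profile p ∣ p ∣ r q
  profile {q} q∈ p⊆q = ∈-subsets q , ∣q∩p∣ , +-cancelˡ-≡ ∣ p ∣ _ _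
    (trans (cong (_+ ∣ q ∩ ∁ p ∣) (sym ∣q∩p∣)) (trans (sym (∣p∣≡∣p∩q∣+∣p∩∁q∣ q p)) (size q∈)))
    where
    ∣q∩p∣ : ∣ q ∩ p ∣ ≡ ∣ p ∣
    ∣q∩p∣ = cong ∣_∣ (p⊆q⇒q∩p≡p p⊆q)

-- Private, full and good sets

-- Used with `o` the number of private sets in a member, whose surplus is `o ∸ 1`: twice the surplus
-- covers all of them, except for a missing 1 when there is just one.
o≤2*[o∸1]+1 : ∀ o → o ≤ 2 * (o ∸ 1) + 1
o≤2*[o∸1]+1 zero = z≤n
o≤2*[o∸1]+1 (suc o) = ≤-trans (≤-reflexive (+-comm 1 o)) (+-monoˡ-≤ 1 (m≤m+n o _))

2≤o⇒o≤2*[o∸1] : ∀ {o} → 2 ≤ o → o ≤ 2 * (o ∸ 1)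
2≤o⇒o≤2*[o∸1] {suc (suc o)} _ = ≤-trans (≤-reflexive (cong suc (+-comm 1 o))) (+-monoʳ-≤ (suc o) (≤-trans (s≤s z≤n) (m≤m+n (suc o) 0)))
2≤o⇒o≤2*[o∸1] {suc zero} (s≤s ())

module Shadow {n κ : ℕ} (F : List (Subset n)) (F-unique : Unique F)
  (F-uniform : ∀ {A} → A L.∈ F → ∣ A ∣ ≡ suc κ) where

  -- Here κ is k - 1. The κ-sets in no member are included, so that the weighted count runs over all
  -- C(n,κ) of them.
  shadows : List (Subset n)
  shadows = filter (λ T → ∣ T ∣ ≟ κ) (subsets n)

  ∈-shadows⁺ : ∀ {T} → ∣ T ∣ ≡ κ → T L.∈ shadows
  ∈-shadows⁺ {T} = ∈-filter⁺ (λ T → ∣ T ∣ ≟ κ) (∈-subsets T)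

  ∈-shadows⁻ : ∀ {T} → T L.∈ shadows → ∣ T ∣ ≡ κ
  ∈-shadows⁻ = proj₂ ∘ ∈-filter⁻ (λ T → ∣ T ∣ ≟ κ) {xs = subsets n}

  -- Absorbs the size condition into the predicate, so that the count by profile over all subsets
  -- applies.
  #-shadows : {P Q : Pred (Subset n) 0ℓ} (P? : Decidable P) (Q? : Decidable Q) →
    (∀ {T} → ∣ T ∣ ≡ κ → P T → Q T) → (∀ {T} → Q T → ∣ T ∣ ≡ κ × P T) →
    # P? shadows ≡ # Q? (subsets n)
  #-shadows P? Q? f g = trans (∑-filter (λ T → ∣ T ∣ ≟ κ) (subsets n) _) (∑-cong (subsets n) λ {T} _ →
    trans (sym (⟦⟧-× (P? T) (∣ T ∣ ≟ κ)))
      (⟦⟧-cong _ (Q? T) (λ (PT , ∣T∣) → f ∣T∣ PT) (λ QT → proj₂ (g QT) , proj₁ (g QT))))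

  length-shadows : length shadows ≡ n C κ
  length-shadows = begin
    length shadows ≡⟨ length-filter≡# (λ T → ∣ T ∣ ≟ κ) (subsets n) ⟩
    # (λ T → ∣ T ∣ ≟ κ) (subsets n) ≡⟨ #-cong _ (profile? ⊤ κ 0) (subsets n) (λ {T} → to {T}) (λ {T} → from {T}) ⟩
    # (profile? ⊤ κ 0) (subsets n) ≡⟨ #-profile (⊤ {n}) κ 0 ⟩
    (∣ ⊤ {n} ∣ C κ) * 1 ≡⟨ *-identityʳ _ ⟩
    ∣ ⊤ {n} ∣ C κ ≡⟨ cong (_C κ) (∣⊤∣≡n n) ⟩
    n C κ ∎
    where
    open ≡-Reasoning
    ∣T∩⊤∣ : ∀ T → ∣ T ∩ ⊤ ∣ ≡ ∣ T ∣
    ∣T∩⊤∣ T = cong ∣_∣ (p⊆q⇒p∩q≡p {p = T} {q = ⊤} (λ _ → ∈⊤))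
    to : ∀ {T} → ∣ T ∣ ≡ κ → Profile ⊤ κ 0 T
    to {T} ∣T∣ = trans (∣T∩⊤∣ T) ∣T∣ , +-cancelˡ-≡ ∣ T ∩ ⊤ ∣ _ _
      (trans (sym (∣p∣≡∣p∩q∣+∣p∩∁q∣ T ⊤)) (trans (sym (∣T∩⊤∣ T)) (sym (+-identityʳ _))))
    from : ∀ {T} → Profile ⊤ κ 0 T → ∣ T ∣ ≡ κ
    from {T} (e , _) = trans (sym (∣T∩⊤∣ T)) e

  #-facets : ∀ {B} → B L.∈ F → # (_⊆? B) shadows ≡ suc κ
  #-facets {B} B∈F = begin
    # (_⊆? B) shadows                ≡⟨ #-shadows (_⊆? B) (profile? B κ 0) to from ⟩
    # (profile? B κ 0) (subsets n)   ≡⟨ #-profile B κ 0 ⟩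
    (∣ B ∣ C κ) * 1                  ≡⟨ *-identityʳ _ ⟩
    ∣ B ∣ C κ                        ≡⟨ cong (_C κ) (F-uniform B∈F) ⟩
    suc κ C κ                        ≡⟨ nCk≡nC[n∸k] (n≤1+n κ) ⟩
    suc κ C (suc κ ∸ κ)              ≡⟨ cong (suc κ C_) (trans (+-∸-assoc 1 {κ} ≤-refl) (cong suc (n∸n≡0 κ))) ⟩
    suc κ C 1                        ≡⟨ nC1≡n (suc κ) ⟩
    suc κ ∎
    where
    open ≡-Reasoning
    to : ∀ {T} → ∣ T ∣ ≡ κ → T ⊆ B → Profile B κ 0 T
    to {T} ∣T∣ T⊆B = trans ∣T∩B∣ ∣T∣ , +-cancelˡ-≡ ∣ T ∩ B ∣ _ _
      (trans (sym (∣p∣≡∣p∩q∣+∣p∩∁q∣ T B)) (trans (sym ∣T∩B∣) (sym (+-identityʳ _))))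
      where
      ∣T∩B∣ : ∣ T ∩ B ∣ ≡ ∣ T ∣
      ∣T∩B∣ = cong ∣_∣ (p⊆q⇒p∩q≡p T⊆B)
    from : ∀ {T} → Profile B κ 0 T → ∣ T ∣ ≡ κ × T ⊆ B
    from {T} (e , e′) = ∣T∣ , λ {x} x∈T → proj₂ (x∈p∩q⁻ T B (subst (x ∈_) (sym T∩B≡T) x∈T))
      where
      ∣T∣ : ∣ T ∣ ≡ κ
      ∣T∣ = trans (∣p∣≡∣p∩q∣+∣p∩∁q∣ T B) (trans (cong₂ _+_ e e′) (+-identityʳ κ))
      T∩B≡T : T ∩ B ≡ T
      T∩B≡T = p⊆q∧∣q∣≤∣p∣⇒p≡q (p∩q⊆p T B) (≤-reflexive (trans ∣T∣ (sym e)))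

  degree : Subset n → ℕ
  degree T = # (T ⊆?_) F

  -- The pairs T ⊆ B with Q T, counted by member and by shadow.
  handshake : {Q : Pred (Subset n) 0ℓ} (Q? : Decidable Q) →
    ∑ F (λ B → # (λ T → (T ⊆? B) ×-dec Q? T) shadows) ≡ ∑ shadows (λ T → ⟦ Q? T ⟧ * degree T)
  handshake Q? = trans (∑-swap F shadows _) (∑-cong shadows λ {T} _ →
    trans (∑-cong F (λ _ → ⟦⟧-× (T ⊆? _) (Q? T))) (∑-*ˡ F ⟦ Q? T ⟧ _))

  ∑-degree : ∑ shadows degree ≡ suc κ * length F
  ∑-degree = begin
    ∑ shadows degree               ≡⟨ ∑-swap F shadows (λ B T → ⟦ T ⊆? B ⟧) ⟨
    ∑ F (λ B → # (_⊆? B) shadows)  ≡⟨ ∑-cong F #-facets ⟩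
    ∑ F (λ _ → suc κ)              ≡⟨ ∑-const F (suc κ) ⟩
    length F * suc κ               ≡⟨ *-comm (length F) (suc κ) ⟩
    suc κ * length F ∎
    where open ≡-Reasoning

  -- A member containing T adds to it one of the `n ∸ κ` points outside T.
  degree≤ : ∀ {T} → ∣ T ∣ ≡ κ → degree T ≤ n ∸ κ
  degree≤ {T} refl = ≤-trans
    (#-⊇≤C T 1 F-unique (λ q∈ → trans (F-uniform q∈) (+-comm 1 κ))) (≤-reflexive (nC1≡n _))

  private? : Decidable (λ T → degree T ≡ 1)
  private? T = degree T ≟ 1

  privates : Subset n → ℕ
  privates B = # (λ T → (T ⊆? B) ×-dec private? T) shadows

  Full : Pred (Subset n) 0ℓ
  Full A = privates A ≡ 0

  full? : Decidable Full
  full? A = privates A ≟ 0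

  -- A private set is counted at exactly one member.
  ∑-privates : ∑ F privates ≡ # private? shadows
  ∑-privates = trans (handshake private?) (∑-cong shadows λ {T} _ → collapse T)
    where
    collapse : ∀ T → ⟦ private? T ⟧ * degree T ≡ ⟦ private? T ⟧
    collapse T with private? T
    ... | yes eq = trans (*-identityˡ _) eq
    ... | no _ = refl

  -- Holds member by member. Truncation gives a full member surplus 0 instead of -1, and the bracket
  -- of `full?` makes up the difference.
  privates+full : # private? shadows + # full? F ≡ length F + ∑ F (λ B → privates B ∸ 1)
  privates+full = begin
    # private? shadows + # full? F               ≡⟨ cong (_+ # full? F) ∑-privates ⟨
    ∑ F privates + # full? F                     ≡⟨ ∑-+ F privates _ ⟨
    ∑ F (λ B → privates B + ⟦ full? B ⟧)         ≡⟨ ∑-cong F (λ {B} _ → shift (privates B)) ⟩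
    ∑ F (λ B → 1 + (privates B ∸ 1))             ≡⟨ ∑-+ F (λ _ → 1) _ ⟩
    ∑ F (λ _ → 1) + ∑ F (λ B → privates B ∸ 1)   ≡⟨ cong (_+ ∑ F (λ B → privates B ∸ 1)) (trans (∑-const F 1) (*-identityʳ _)) ⟩
    length F + ∑ F (λ B → privates B ∸ 1) ∎
    where
    open ≡-Reasoning
    shift : ∀ o → o + ⟦ o ≟ 0 ⟧ ≡ 1 + (o ∸ 1)
    shift zero = refl
    shift (suc o) = +-identityʳ (suc o)

  -- The set A - x lies in A and is not private, so a second member contains it; if that member also
  -- contained x, it would be A.
  full⇒neighbour : ∀ {A x} → A L.∈ F → Full A → x ∈ A → ∃[ C ] (C L.∈ F × A - x ⊆ C × x ∉ C)
  full⇒neighbour {A} {x} A∈F full x∈A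
    with #-another _≟ˢ_ ((A - x) ⊆?_) F-unique A∈F (x∈p-y⇒x∈p {p = A}) degree≢1
    where
    ∣A-x∣ : ∣ A - x ∣ ≡ κ
    ∣A-x∣ = suc-injective (trans (sym (∣p∣≡1+∣p-x∣ x∈A)) (F-uniform A∈F))
    degree≢1 : degree (A - x) ≢ 1
    degree≢1 deg≡1 = contradiction full (>⇒≢
      (#-∈ (λ T → (T ⊆? A) ×-dec private? T) (∈-shadows⁺ ∣A-x∣) (x∈p-y⇒x∈p {p = A} , deg≡1)))
  ... | C , C∈F , A-x⊆C , C≢A = C , C∈F , A-x⊆C , λ x∈C → C≢A (sym (p⊆q∧∣q∣≤∣p∣⇒p≡q (A⊆C x∈C)
        (≤-reflexive (trans (F-uniform C∈F) (sym (F-uniform A∈F))))))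
    where
    A⊆C : x ∈ C → A ⊆ C
    A⊆C x∈C {y} y∈A with y Fin.≟ x
    ... | yes refl = x∈C
    ... | no y≢x = A-x⊆C (x∈p∧x≢y⇒x∈p-y y∈A y≢x)

  -- The counting sees the conditional intersection of the family through this property alone; it is
  -- derived from that condition afterwards.
  module _ (full-meets : ∀ {A B} → A L.∈ F → B L.∈ F → Full A → ∣ A ∩ B ∣ ≢ 1) where

    Good : Pred (Subset n) 0ℓ
    Good T = Any (λ A → Full A × ∣ T ∩ A ∣ ≡ 1) F

    good? : Decidable Good
    good? T = Any.any? (λ A → full? A ×-dec (∣ T ∩ A ∣ ≟ 1)) F

    other? : Decidable (λ T → Good T × degree T ≢ 1)
    other? T = good? T ×-dec ¬? (private? T)

    private
      -- The single point x of T ∩ A lies in A ∩ B, which is not a singleton and so has a second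
      -- point y. That point is outside T, since T ∩ A is exhausted by x.
      second-point : ∀ {A B T} → A L.∈ F → Full A → ∣ T ∩ A ∣ ≡ 1 → B L.∈ F → T ⊆ B →
        ∃[ x ] ∃[ y ] (x ∈ T × x ∈ A × y ∈ A × y ∈ B × y ∉ T)
      second-point {A} {B} {T} A∈F full ∣T∩A∣ B∈F T⊆B
        with 1≤∣p∣⇒Nonempty {p = T ∩ A} (≤-reflexive (sym ∣T∩A∣))
      ... | x , x∈T∩A with x∈p∩q⁻ T A x∈T∩A
      ...   | x∈T , x∈A
        with x∈p∧∣p∣≢1⇒another (x∈p∩q⁺ (x∈A , T⊆B x∈T)) (full-meets A∈F B∈F full)
      ...     | y , y∈A∩B , y≢x with x∈p∩q⁻ A B y∈A∩B
      ...       | y∈A , y∈B = x , y , x∈T , x∈A , y∈A , y∈B ,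
                  λ y∈T → y≢x (∣p∣≡1⇒≡ ∣T∩A∣ x∈T∩A (x∈p∩q⁺ (y∈T , y∈A)))

    -- By `second-point` every member containing T contains a point y of A outside T. Then T with y
    -- already has k points, so each y accounts for at most one member.
    good⇒degree≤ : ∀ {T} → ∣ T ∣ ≡ κ → Good T → degree T ≤ suc κ
    good⇒degree≤ {T} ∣T∣ good with L.find good
    ... | A , A∈F , full , ∣T∩A∣ = begin
      degree T                             ≤⟨ #-cover (T ⊆?_) (λ y → (T ∪ ⁅ y ⁆) ⊆?_) F (elements (A ∩ ∁ T)) cover unit ⟩
      length (elements (A ∩ ∁ T)) * 1      ≡⟨ *-identityʳ _ ⟩
      length (elements (A ∩ ∁ T))          ≡⟨ length-elements (A ∩ ∁ T) ⟩
      ∣ A ∩ ∁ T ∣                          ≤⟨ ∣p∩q∣≤∣p∣ A (∁ T) ⟩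
      ∣ A ∣                                ≡⟨ F-uniform A∈F ⟩
      suc κ ∎
      where
      open ≤-Reasoning
      cover : ∀ {B} → B L.∈ F → T ⊆ B → ∃[ y ] (y L.∈ elements (A ∩ ∁ T) × (T ∪ ⁅ y ⁆) ⊆ B)
      cover B∈F T⊆B with second-point A∈F full ∣T∩A∣ B∈F T⊆B
      ... | _ , y , _ , _ , y∈A , y∈B , y∉T =
        y , ∈-elements⁺ (x∈p∩q⁺ (y∈A , x∉p⇒x∈∁p y∉T)) , p∪⁅x⁆⊆q T⊆B y∈B
      unit : ∀ {y} → y L.∈ elements (A ∩ ∁ T) → # ((T ∪ ⁅ y ⁆) ⊆?_) F ≤ 1
      unit {y} y∈ = #-⊇≤C (T ∪ ⁅ y ⁆) 0 F-unique (λ q∈ →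
        trans (F-uniform q∈) (trans (cong suc (sym ∣T∣)) (trans (sym (∣p∪⁅x⁆∣≡1+∣p∣ y∉T)) (sym (+-identityʳ _)))))
        where
        y∉T : y ∉ T
        y∉T = x∈∁p⇒x∉p (proj₂ (x∈p∩q⁻ A (∁ T) (∈-elements⁻ y∈)))

    -- The exchange T = B - y ↦ B - x, where B ∩ A = {x , y}.
    good-exchange : ∀ {T B} → ∣ T ∣ ≡ κ → Good T → B L.∈ F → T ⊆ B →
      ∃[ T′ ] (∣ T′ ∣ ≡ κ × Good T′ × T′ ⊆ B × T ≢ T′)
    good-exchange {T} {B} ∣T∣ good B∈F T⊆B with L.find good
    ... | A , A∈F , full , ∣T∩A∣ with second-point A∈F full ∣T∩A∣ B∈F T⊆B
    ...   | x , y , x∈T , x∈A , y∈A , y∈B , y∉T =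
      B - x , ∣B-x∣ , L.lose A∈F (full , ∣B-x∩A∣) , x∈p-y⇒x∈p {p = B} ,
      λ T≡ → x∉p-x {p = B} (subst (x ∈_) T≡ x∈T)
      where
      ∣B-x∣ : ∣ B - x ∣ ≡ κ
      ∣B-x∣ = suc-injective (trans (sym (∣p∣≡1+∣p-x∣ (T⊆B x∈T))) (F-uniform B∈F))
      ∣B∩∁T∣ : ∣ B ∩ ∁ T ∣ ≡ 1
      ∣B∩∁T∣ = +-cancelˡ-≡ κ _ _ (begin
        κ + ∣ B ∩ ∁ T ∣            ≡⟨ cong (_+ ∣ B ∩ ∁ T ∣) (trans (sym ∣T∣) (cong ∣_∣ (sym (p⊆q⇒q∩p≡p T⊆B)))) ⟩
        ∣ B ∩ T ∣ + ∣ B ∩ ∁ T ∣    ≡⟨ ∣p∣≡∣p∩q∣+∣p∩∁q∣ B T ⟨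
        ∣ B ∣                      ≡⟨ F-uniform B∈F ⟩
        suc κ                      ≡⟨ +-comm 1 κ ⟩
        κ + 1 ∎)
        where open ≡-Reasoning
      x≢y : x ≢ y
      x≢y refl = y∉T x∈T
      -- One point inside T, because T meets A once, and at most one outside, because B has a single
      -- point outside T.
      B∩A≤2 : ∣ B ∩ A ∣ ≤ 2
      B∩A≤2 = begin
        ∣ B ∩ A ∣                              ≡⟨ ∣p∣≡∣p∩q∣+∣p∩∁q∣ (B ∩ A) T ⟩
        ∣ (B ∩ A) ∩ T ∣ + ∣ (B ∩ A) ∩ ∁ T ∣    ≤⟨ +-mono-≤ (p⊆q⇒∣p∣≤∣q∣ ⊆T∩A) (p⊆q⇒∣p∣≤∣q∣ ⊆B∩∁T) ⟩
        ∣ T ∩ A ∣ + ∣ B ∩ ∁ T ∣                ≡⟨ cong₂ _+_ ∣T∩A∣ ∣B∩∁T∣ ⟩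
        2 ∎
        where
        open ≤-Reasoning
        ⊆T∩A : (B ∩ A) ∩ T ⊆ T ∩ A
        ⊆T∩A z∈ with x∈p∩q⁻ (B ∩ A) T z∈
        ... | z∈BA , z∈T = x∈p∩q⁺ (z∈T , proj₂ (x∈p∩q⁻ B A z∈BA))
        ⊆B∩∁T : (B ∩ A) ∩ ∁ T ⊆ B ∩ ∁ T
        ⊆B∩∁T z∈ with x∈p∩q⁻ (B ∩ A) (∁ T) z∈
        ... | z∈BA , z∈T = x∈p∩q⁺ (proj₁ (x∈p∩q⁻ B A z∈BA) , z∈T)
      ∣B-x∩A∣ : ∣ (B - x) ∩ A ∣ ≡ 1
      ∣B-x∩A∣ = ≤-antisym
        (≤-trans (p⊆q⇒∣p∣≤∣q∣ ⊆B∩A-x)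
          (s≤s⁻¹ (≤-trans (≤-reflexive (sym (∣p∣≡1+∣p-x∣ (x∈p∩q⁺ (T⊆B x∈T , x∈A))))) B∩A≤2)))
        (x∈p⇒1≤∣p∣ (x∈p∩q⁺ (x∈p∧x≢y⇒x∈p-y y∈B (x≢y ∘ sym) , y∈A)))
        where
        ⊆B∩A-x : (B - x) ∩ A ⊆ (B ∩ A) - x
        ⊆B∩A-x z∈ with x∈p∩q⁻ (B - x) A z∈
        ... | z∈B-x , z∈A = x∈p∧x≢y⇒x∈p-y (x∈p∩q⁺ (x∈p-y⇒x∈p {p = B} z∈B-x , z∈A))
          (λ { refl → x∉p-x {p = B} z∈B-x })

    -- A private good set is charged to the member B containing it, where `good-exchange` finds a
    -- second good set. The charge is paid by the surplus of B or by a good set in B that is not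
    -- private; the good sets that are not private add their own number.
    #-good : # good? shadows ≤ 2 * ∑ F (λ B → privates B ∸ 1)
      + (1 + suc κ) * # other? shadows
    #-good = begin
      # good? shadows                                       ≡⟨ ∑-cong shadows (λ {T} _ → ⟦⟧-split (good? T) (private? T)) ⟩
      ∑ shadows (λ T → ⟦ own? T ⟧ + ⟦ other? T ⟧)           ≡⟨ ∑-+ shadows _ _ ⟩
      # own? shadows + L                                    ≤⟨ +-monoˡ-≤ L own≤ ⟩
      2 * J + suc κ * L + L                                 ≡⟨ rearrange (2 * J) (suc κ) L ⟩
      2 * J + (1 + suc κ) * L ∎
      where
      open ≤-Reasoning
      own? : Decidable (λ T → Good T × degree T ≡ 1)
      own? T = good? T ×-dec private? T
      J = ∑ F (λ B → privates B ∸ 1)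
      L = # other? shadows
      rearrange : ∀ a k L → a + k * L + L ≡ a + (1 + k) * L
      rearrange = solve-∀
      ownIn : Subset n → ℕ
      ownIn B = # (λ T → (T ⊆? B) ×-dec own? T) shadows
      otherIn : Subset n → ℕ
      otherIn B = # (λ T → (T ⊆? B) ×-dec other? T) shadows
      -- A private set has degree 1, so weighting by the degree is free and makes `handshake`
      -- applicable.
      own≤degree : ∀ T → ⟦ own? T ⟧ ≤ ⟦ own? T ⟧ * degree T
      own≤degree T with good? T | private? T
      ... | yes _ | yes eq = ≤-reflexive (sym (trans (*-identityˡ _) eq))
      ... | yes _ | no _ = z≤n
      ... | no _ | _ = z≤n
      other*degree≤ : ∀ {T} → T L.∈ shadows → ⟦ other? T ⟧ * degree T ≤ suc κ * ⟦ other? T ⟧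
      other*degree≤ {T} T∈ with other? T
      ... | no _ = z≤n
      ... | yes (good , _) = subst₂ _≤_ (sym (*-identityˡ _)) (sym (*-identityʳ _)) (good⇒degree≤ (∈-shadows⁻ T∈) good)
      ownIn≤privates : ∀ B → ownIn B ≤ privates B
      ownIn≤privates B = #-mono (λ T → (T ⊆? B) ×-dec own? T) (λ T → (T ⊆? B) ×-dec private? T)
        shadows (λ _ (T⊆B , _ , eq) → T⊆B , eq)
      -- If T′ is private too, B has at least two private sets and twice its surplus covers them;
      -- otherwise T′ pays for the missing 1.
      exchange-bound : ∀ {B T T′} → T L.∈ shadows → T ⊆ B → degree T ≡ 1 →
        T′ L.∈ shadows → T′ ⊆ B → Good T′ → T ≢ T′ → Dec (degree T′ ≡ 1) →
        privates B ≤ 2 * (privates B ∸ 1) + otherIn B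
      exchange-bound {B} T∈ T⊆B eq T′∈ T′⊆B good′ T≢T′ (yes eq′) = ≤-trans
        (2≤o⇒o≤2*[o∸1] (#-∈₂ (λ T → (T ⊆? B) ×-dec private? T) T∈ (T⊆B , eq) T′∈ (T′⊆B , eq′) T≢T′))
        (m≤m+n _ _)
      exchange-bound {B} T∈ T⊆B eq T′∈ T′⊆B good′ T≢T′ (no neq) = ≤-trans
        (o≤2*[o∸1]+1 (privates B))
        (+-monoʳ-≤ _ (#-∈ (λ T → (T ⊆? B) ×-dec other? T) T′∈ (T′⊆B , good′ , neq)))
      local : ∀ {B} → B L.∈ F → Dec (1 ≤ ownIn B) → ownIn B ≤ 2 * (privates B ∸ 1) + otherIn B
      local B∈F (no 1≰) = ≤-trans (≤-reflexive (n<1⇒n≡0 (≰⇒> 1≰))) z≤n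
      local {B} B∈F (yes 1≤) with #-witness (λ T → (T ⊆? B) ×-dec own? T) shadows 1≤
      ... | T , T∈ , T⊆B , good , eq with good-exchange (∈-shadows⁻ T∈) good B∈F T⊆B
      ...   | T′ , ∣T′∣ , good′ , T′⊆B , T≢T′ = ≤-trans (ownIn≤privates B)
        (exchange-bound T∈ T⊆B eq (∈-shadows⁺ ∣T′∣) T′⊆B good′ T≢T′ (private? T′))
      own≤ : # own? shadows ≤ 2 * J + suc κ * L
      own≤ = begin
        # own? shadows                                         ≤⟨ ∑-mono shadows (λ {T} _ → own≤degree T) ⟩
        ∑ shadows (λ T → ⟦ own? T ⟧ * degree T)                ≡⟨ handshake own? ⟨
        ∑ F ownIn                                              ≤⟨ ∑-mono F (λ B∈F → local B∈F (1 ≤? ownIn _)) ⟩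
        ∑ F (λ B → 2 * (privates B ∸ 1) + otherIn B)           ≡⟨ ∑-+ F _ _ ⟩
        ∑ F (λ B → 2 * (privates B ∸ 1)) + ∑ F otherIn         ≡⟨ cong₂ _+_ (∑-*ˡ F 2 _) (handshake other?) ⟩
        -- A good set that is not private may pay once in each member containing it, hence at most k
        -- times.
        2 * J + ∑ shadows (λ T → ⟦ other? T ⟧ * degree T)      ≤⟨ +-monoʳ-≤ (2 * J) (∑-mono shadows other*degree≤) ⟩
        2 * J + ∑ shadows (λ T → suc κ * ⟦ other? T ⟧)         ≡⟨ cong (2 * J +_) (∑-*ˡ shadows (suc κ) (λ T → ⟦ other? T ⟧)) ⟩
        2 * J + suc κ * L ∎

    -- No shadow weighs more than N = `suc m`: a private set weighs 1 + m, a good set that is not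
    -- private at most k + q, and any other set its degree, at most n - κ = N.
    weighted-count : ∀ m q → n ∸ κ ≡ suc m → q + suc κ ≤ suc m →
      suc κ * length F + m * # private? shadows + q * # other? shadows
        ≤ suc m * (n C κ)
    weighted-count m q n∸κ≡1+m q+k≤1+m = begin
      suc κ * length F + m * # private? shadows + q * # other? shadows
        ≡⟨ cong₂ _+_ (cong₂ _+_ ∑-degree (∑-*ˡ shadows m (λ T → ⟦ private? T ⟧))) (∑-*ˡ shadows q (λ T → ⟦ other? T ⟧)) ⟨
      ∑ shadows degree + ∑ shadows (λ T → m * ⟦ private? T ⟧) + ∑ shadows (λ T → q * ⟦ other? T ⟧)
        ≡⟨ cong (_+ ∑ shadows (λ T → q * ⟦ other? T ⟧)) (∑-+ shadows degree _) ⟨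
      ∑ shadows (λ T → degree T + m * ⟦ private? T ⟧) + ∑ shadows (λ T → q * ⟦ other? T ⟧)
        ≡⟨ ∑-+ shadows _ _ ⟨
      ∑ shadows (λ T → degree T + m * ⟦ private? T ⟧ + q * ⟦ other? T ⟧)
        ≤⟨ ∑-≤ shadows pointwise ⟩
      length shadows * suc m
        ≡⟨ cong (_* suc m) length-shadows ⟩
      (n C κ) * suc m
        ≡⟨ *-comm (n C κ) (suc m) ⟩
      suc m * (n C κ) ∎
      where
      open ≤-Reasoning
      pointwise : ∀ {T} → T L.∈ shadows → degree T + m * ⟦ private? T ⟧ + q * ⟦ other? T ⟧ ≤ suc m
      pointwise {T} T∈ with private? T | good? T
      ... | yes eq | yes _ = ≤-reflexive (trans (cong₂ _+_ (cong₂ _+_ eq (*-identityʳ m)) (*-zeroʳ q)) (+-identityʳ _))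
      ... | yes eq | no _ = ≤-reflexive (trans (cong₂ _+_ (cong₂ _+_ eq (*-identityʳ m)) (*-zeroʳ q)) (+-identityʳ _))
      ... | no _ | no _ = ≤-trans (≤-reflexive (trans (cong₂ _+_ (cong (degree T +_) (*-zeroʳ m)) (*-zeroʳ q)) (trans (+-identityʳ _) (+-identityʳ _))))
        (≤-trans (degree≤ (∈-shadows⁻ T∈)) (≤-reflexive n∸κ≡1+m))
      ... | no _ | yes good = begin
        degree T + m * 0 + q * 1  ≡⟨ cong₂ _+_ (trans (cong (degree T +_) (*-zeroʳ m)) (+-identityʳ _)) (*-identityʳ q) ⟩
        degree T + q              ≤⟨ +-monoˡ-≤ q (good⇒degree≤ (∈-shadows⁻ T∈) good) ⟩
        suc κ + q                 ≡⟨ +-comm (suc κ) q ⟩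
        q + suc κ                 ≤⟨ q+k≤1+m ⟩
        suc m ∎

-- Unions and intersections of lists of sets

∣[p∪q]∩r∣≤∣p∩r∣+∣q∩r∣ : ∀ {n} (p q r : Subset n) → ∣ (p ∪ q) ∩ r ∣ ≤ ∣ p ∩ r ∣ + ∣ q ∩ r ∣
∣[p∪q]∩r∣≤∣p∩r∣+∣q∩r∣ p q r = begin
  ∣ (p ∪ q) ∩ r ∣                           ≡⟨ cong ∣_∣ (∩-distribʳ-∪ r p q) ⟩
  ∣ (p ∩ r) ∪ (q ∩ r) ∣                     ≤⟨ ∣p∪q∣≤∣p∣+∣q∩∁p∣ (p ∩ r) (q ∩ r) ⟩
  ∣ p ∩ r ∣ + ∣ (q ∩ r) ∩ ∁ (p ∩ r) ∣       ≤⟨ +-monoʳ-≤ _ (∣p∩q∣≤∣p∣ (q ∩ r) _) ⟩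
  ∣ p ∩ r ∣ + ∣ q ∩ r ∣ ∎
  where open ≤-Reasoning

∣⋃∩p∣≤length : ∀ {n} (p : Subset n) (qs : List (Subset n)) → All (λ q → ∣ q ∩ p ∣ ≤ 1) qs →
  ∣ ⋃ qs ∩ p ∣ ≤ length qs
∣⋃∩p∣≤length {n} p [] [] = ≤-trans (∣p∩q∣≤∣p∣ ⊥ p) (≤-reflexive (∣⊥∣≡0 n))
∣⋃∩p∣≤length p (q ∷ qs) (q≤ ∷ qs≤) =
  ≤-trans (∣[p∪q]∩r∣≤∣p∩r∣+∣q∩r∣ q (⋃ qs) p) (+-mono-≤ q≤ (∣⋃∩p∣≤length p qs qs≤))

⋂⊆ : ∀ {n} {q : Subset n} {qs} → q L.∈ qs → ⋂ qs ⊆ q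
⋂⊆ {qs = q ∷ qs} (here refl) x∈ = proj₁ (x∈p∩q⁻ q (⋂ qs) x∈)
⋂⊆ {qs = q ∷ qs} (there q∈) x∈ = ⋂⊆ q∈ (proj₂ (x∈p∩q⁻ q (⋂ qs) x∈))

-- The number of full sets

module Fulls {j m : ℕ} (F : List (Subset (m + (3 + j)))) (F-unique : Unique F)
  (F-uniform : ∀ {A} → A L.∈ F → ∣ A ∣ ≡ 3 + j) where

  open Shadow F F-unique F-uniform public

  private
    k = 3 + j
    -- With n = m + k this is C(n-3,k-3), the number of k-sets through three given points.
    c = (j + m) C j

  module _ (full-meets : ∀ {A B} → A L.∈ F → B L.∈ F → Full A → ∣ A ∩ B ∣ ≢ 1) where

    fulls : List (Subset (m + k))
    fulls = filter full? F

    ∈-fulls⁻ : ∀ {A} → A L.∈ fulls → A L.∈ F × Full A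
    ∈-fulls⁻ = ∈-filter⁻ full? {xs = F}

    fulls-unique : Unique fulls
    fulls-unique = Unique.filter⁺ full? F-unique

    #-fulls-through₃ : ∀ {x y z} → y ≢ x → z ≢ x → z ≢ y →
      # (λ A → (x ∈? A) ×-dec ((y ∈? A) ×-dec (z ∈? A))) fulls ≤ c
    #-fulls-through₃ {x} {y} {z} y≢x z≢x z≢y = begin
      # (λ A → (x ∈? A) ×-dec ((y ∈? A) ×-dec (z ∈? A))) fulls
        ≤⟨ #-mono (λ A → (x ∈? A) ×-dec ((y ∈? A) ×-dec (z ∈? A))) (xyz ⊆?_) fulls (λ {A} _ → include {A}) ⟩
      # (xyz ⊆?_) fulls
        ≤⟨ #-⊇≤C xyz j fulls-unique (λ A∈ → trans (F-uniform (proj₁ (∈-fulls⁻ A∈))) (cong (_+ j) (sym ∣xyz∣≡3))) ⟩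
      (m + k ∸ ∣ xyz ∣) C j
        ≡⟨ cong (_C j) (trans (cong (m + k ∸_) ∣xyz∣≡3) (trans (cong (_∸ 3) (rearrange m j)) (m+n∸m≡n 3 (j + m)))) ⟩
      c ∎
      where
      open ≤-Reasoning
      xyz = (⁅ x ⁆ ∪ ⁅ y ⁆) ∪ ⁅ z ⁆
      rearrange : ∀ m j → m + (3 + j) ≡ 3 + (j + m)
      rearrange = solve-∀
      y∉ : y ∉ ⁅ x ⁆
      y∉ = x≢y⇒x∉⁅y⁆ y≢x
      z∉ : z ∉ ⁅ x ⁆ ∪ ⁅ y ⁆
      z∉ z∈ with x∈p∪q⁻ ⁅ x ⁆ ⁅ y ⁆ z∈
      ... | inj₁ z∈x = z≢x (x∈⁅y⁆⇒x≡y x z∈x)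
      ... | inj₂ z∈y = z≢y (x∈⁅y⁆⇒x≡y y z∈y)
      ∣xyz∣≡3 : ∣ xyz ∣ ≡ 3
      ∣xyz∣≡3 = trans (∣p∪⁅x⁆∣≡1+∣p∣ z∉) (cong suc (trans (∣p∪⁅x⁆∣≡1+∣p∣ y∉) (cong suc (∣⁅x⁆∣≡1 x))))
      include : ∀ {A} → x ∈ A × y ∈ A × z ∈ A → xyz ⊆ A
      include {A} (x∈ , y∈ , z∈) = p∪⁅x⁆⊆q (p∪⁅x⁆⊆q (λ u∈ → subst (_∈ A) (sym (x∈⁅y⁆⇒x≡y x u∈)) x∈) y∈) z∈

    -- An upper bound on a count may assume that something is counted. This yields a full set from
    -- which to start a cover, and lets side conditions stored in P be read off.
    bound-by-member : ∀ {P : Pred (Subset (m + k)) 0ℓ} (P? : Decidable P) {b} →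
      (∀ {A} → A L.∈ F → Full A → P A → # P? fulls ≤ b) → # P? fulls ≤ b
    bound-by-member P? bound with 1 ≤? # P? fulls
    ... | no 1≰ = ≤-trans (≤-reflexive (n<1⇒n≡0 (≰⇒> 1≰))) z≤n
    ... | yes 1≤ with #-witness P? fulls 1≤
    ...   | A , A∈ , PA = bound (proj₁ (∈-fulls⁻ A∈)) (proj₂ (∈-fulls⁻ A∈)) PA

    length-elements-F : ∀ {A} → A L.∈ F → length (elements A) ≡ k
    length-elements-F {A} A∈F = trans (length-elements A) (F-uniform A∈F)

    -- A member C ⊇ A - x avoiding x meets every full set through x and y in a third point.
    #-fulls-through₂ : ∀ {x y} → y ≢ x → # (λ A → (x ∈? A) ×-dec (y ∈? A)) fulls ≤ k * c
    #-fulls-through₂ {x} {y} y≢x = bound-by-member P? bound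
      where
      P? : Decidable (λ A → x ∈ A × y ∈ A)
      P? A = (x ∈? A) ×-dec (y ∈? A)
      bound : ∀ {A} → A L.∈ F → Full A → x ∈ A × y ∈ A → # P? fulls ≤ k * c
      bound {A} A∈F full (x∈A , y∈A) with full⇒neighbour A∈F full x∈A
      ... | C′ , C′∈F , A-x⊆C′ , x∉C′ = ≤-trans
        -- The conditions on `z` alone are kept in the predicate so that `bound-by-member` can
        -- recover them in `unit`.
        (#-cover P? (λ z B → (¬? (z Fin.≟ y) ×-dec (z ∈? C′)) ×-dec ((x ∈? B) ×-dec ((y ∈? B) ×-dec (z ∈? B))))
          fulls (elements C′) cover unit)
        (≤-reflexive (cong (_* c) (length-elements-F C′∈F)))
        where
        cover : ∀ {B} → B L.∈ fulls → x ∈ B × y ∈ B →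
          ∃[ z ] (z L.∈ elements C′ × (z ≢ y × z ∈ C′) × (x ∈ B × y ∈ B × z ∈ B))
        cover {B} B∈ (x∈B , y∈B) with ∈-fulls⁻ B∈
        ... | B∈F , fullB with x∈p∧∣p∣≢1⇒another (x∈p∩q⁺ (y∈B , A-x⊆C′ (x∈p∧x≢y⇒x∈p-y y∈A y≢x))) (full-meets B∈F C′∈F fullB)
        ...   | z , z∈ , z≢y with x∈p∩q⁻ B C′ z∈
        ...     | z∈B , z∈C′ = z , ∈-elements⁺ z∈C′ , (z≢y , z∈C′) , (x∈B , y∈B , z∈B)
        unit : ∀ {z} → z L.∈ elements C′ →
          # (λ B → (¬? (z Fin.≟ y) ×-dec (z ∈? C′)) ×-dec ((x ∈? B) ×-dec ((y ∈? B) ×-dec (z ∈? B)))) fulls ≤ c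
        -- The third point differs from `x` because C′ avoids `x`.
        unit {z} z∈ = bound-by-member _ (λ { _ _ ((z≢y , z∈C′) , _) → ≤-trans
          (#-mono _ (λ B → (x ∈? B) ×-dec ((y ∈? B) ×-dec (z ∈? B))) fulls (λ _ → proj₂))
          (#-fulls-through₃ y≢x (λ { refl → x∉C′ z∈C′ }) z≢y) })

    -- Fix a full A through x. Every full set through x meets A in a second point, for which there
    -- are at most k choices, and each resulting pair of points lies in at most k c full sets.
    #-fulls-through : ∀ x → # (x ∈?_) fulls ≤ k * (k * c)
    #-fulls-through x = bound-by-member (x ∈?_) bound
      where
      bound : ∀ {A} → A L.∈ F → Full A → x ∈ A → # (x ∈?_) fulls ≤ k * (k * c)
      bound {A} A∈F full x∈A = ≤-trans
        (#-cover (x ∈?_) (λ y B → ¬? (y Fin.≟ x) ×-dec ((x ∈? B) ×-dec (y ∈? B))) fulls (elements A) cover unit)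
        (≤-reflexive (cong (_* (k * c)) (length-elements-F A∈F)))
        where
        cover : ∀ {B} → B L.∈ fulls → x ∈ B → ∃[ y ] (y L.∈ elements A × y ≢ x × x ∈ B × y ∈ B)
        cover {B} B∈ x∈B
          with x∈p∧∣p∣≢1⇒another (x∈p∩q⁺ (x∈A , x∈B)) (full-meets A∈F (proj₁ (∈-fulls⁻ B∈)) full)
        ... | y , y∈ , y≢x with x∈p∩q⁻ A B y∈
        ...   | y∈A , y∈B = y , ∈-elements⁺ y∈A , y≢x , x∈B , y∈B
        unit : ∀ {y} → y L.∈ elements A → # (λ B → ¬? (y Fin.≟ x) ×-dec ((x ∈? B) ×-dec (y ∈? B))) fulls ≤ k * c
        unit {y} y∈ = bound-by-member _ (λ { _ _ (y≢x , _) → ≤-trans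
          (#-mono _ (λ B → (x ∈? B) ×-dec (y ∈? B)) fulls (λ _ → proj₂)) (#-fulls-through₂ y≢x) })

    -- Double counting of the pairs (T,A) with A full and T ∩ A a single point. Each A has k choices
    -- for that point and C(m,k-2) for the rest of T; a good T has fewer than k points, each in at
    -- most k² c full sets.
    #-pairs : # full? F * (k * (m C suc j)) ≤ # (good? full-meets) shadows * (k * (k * (k * c)))
    #-pairs = begin
      # full? F * (k * (m C suc j))
        ≡⟨ cong (_* (k * (m C suc j))) (length-filter≡# full? F) ⟨
      length fulls * (k * (m C suc j))
        ≡⟨ ∑-const fulls _ ⟨
      ∑ fulls (λ _ → k * (m C suc j))
        ≡⟨ ∑-cong fulls per-full ⟨
      ∑ fulls (λ A → # (λ T → ∣ T ∩ A ∣ ≟ 1) shadows)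
        ≡⟨ ∑-swap fulls shadows (λ A T → ⟦ ∣ T ∩ A ∣ ≟ 1 ⟧) ⟩
      ∑ shadows (λ T → # (λ A → ∣ T ∩ A ∣ ≟ 1) fulls)
        ≤⟨ ∑-mono shadows (λ {T} T∈ → per-shadow T T∈ (good? full-meets T)) ⟩
      ∑ shadows (λ T → b * ⟦ good? full-meets T ⟧)
        ≡⟨ ∑-*ˡ shadows b (λ T → ⟦ good? full-meets T ⟧) ⟩
      b * # (good? full-meets) shadows
        ≡⟨ *-comm b _ ⟩
      # (good? full-meets) shadows * b ∎
      where
      open ≤-Reasoning
      b = k * (k * (k * c))
      per-full : ∀ {A} → A L.∈ fulls → # (λ T → ∣ T ∩ A ∣ ≟ 1) shadows ≡ k * (m C suc j)
      per-full {A} A∈ = trans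
        (#-shadows (λ T → ∣ T ∩ A ∣ ≟ 1) (profile? A 1 (suc j)) (λ {T} → to {T}) (λ {T} → from {T}))
        (trans (#-profile A 1 (suc j)) (cong₂ _*_ (trans (nC1≡n ∣ A ∣) ∣A∣)
          (cong (_C suc j) (trans (∣∁p∣≡n∸∣p∣ A) (trans (cong (m + k ∸_) ∣A∣) (m+n∸n≡m m k))))))
        where
        ∣A∣ : ∣ A ∣ ≡ k
        ∣A∣ = F-uniform (proj₁ (∈-fulls⁻ A∈))
        to : ∀ {T} → ∣ T ∣ ≡ 2 + j → ∣ T ∩ A ∣ ≡ 1 → Profile A 1 (suc j) T
        to {T} ∣T∣ eq = eq , suc-injective (trans (cong (_+ ∣ T ∩ ∁ A ∣) (sym eq)) (trans (sym (∣p∣≡∣p∩q∣+∣p∩∁q∣ T A)) ∣T∣))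
        from : ∀ {T} → Profile A 1 (suc j) T → ∣ T ∣ ≡ 2 + j × ∣ T ∩ A ∣ ≡ 1
        from {T} (e , e′) = trans (∣p∣≡∣p∩q∣+∣p∩∁q∣ T A) (cong₂ _+_ e e′) , e
      per-shadow : ∀ T → T L.∈ shadows → (g : Dec (Good full-meets T)) →
        # (λ A → ∣ T ∩ A ∣ ≟ 1) fulls ≤ b * ⟦ g ⟧
      per-shadow T T∈ (no ¬good) = ≤-trans (≤-reflexive (#-none (λ A → ∣ T ∩ A ∣ ≟ 1) fulls λ A∈ eq →
        ¬good (L.lose (proj₁ (∈-fulls⁻ A∈)) (proj₂ (∈-fulls⁻ A∈) , eq)))) z≤n
      per-shadow T T∈ (yes _) = begin
        # (λ A → ∣ T ∩ A ∣ ≟ 1) fulls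
          ≤⟨ #-cover (λ A → ∣ T ∩ A ∣ ≟ 1) _∈?_ fulls (elements T) cover (λ {x} _ → #-fulls-through x) ⟩
        length (elements T) * (k * (k * c))
          ≡⟨ cong (_* (k * (k * c))) (trans (length-elements T) (∈-shadows⁻ T∈)) ⟩
        (2 + j) * (k * (k * c))
          ≤⟨ *-monoˡ-≤ (k * (k * c)) (n≤1+n (2 + j)) ⟩
        b
          ≡⟨ *-identityʳ b ⟨
        b * 1 ∎
        where
        cover : ∀ {A} → A L.∈ fulls → ∣ T ∩ A ∣ ≡ 1 → ∃[ x ] (x L.∈ elements T × x ∈ A)
        cover {A} _ eq with 1≤∣p∣⇒Nonempty {p = T ∩ A} (≤-reflexive (sym eq))
        ... | x , x∈ with x∈p∩q⁻ T A x∈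
        ...   | x∈T , x∈A = x , ∈-elements⁺ x∈T , x∈A

-- Full sets never meet a member in exactly one point

full-meets : ∀ {n j e} → e ≤ j → (F : Family n (3 + j)) →
  ConditionallyIntersecting (3 + e) ((2 * (3 + j) + (3 + e)) ∸ 3) F →
  let open Shadow (members F) (unique F) (All.lookup (uniform F)) in
  ∀ {A B} → A L.∈ members F → B L.∈ members F → Full A → ∣ A ∩ B ∣ ≢ 1
full-meets {n} {j} {e} e≤j F cond {A} {B} A∈F B∈F full ∣A∩B∣≡1
  with 1≤∣p∣⇒Nonempty {p = A ∩ B} (≤-reflexive (sym ∣A∩B∣≡1))
... | x , x∈A∩B = refute (neighbours (x ∷ others) distinct inA)
  where
  open Shadow (members F) (unique F) (All.lookup (uniform F))

  Neighbour : Fin n → Pred (Subset n) 0ℓ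
  Neighbour y C = A - y ⊆ C × y ∉ C

  -- Neighbours for different points are different: the one for z contains A - z and hence y, while
  -- the one for y avoids y.
  neighbours : ∀ ys → Unique ys → All (_∈ A) ys → ∃[ Cs ] (length Cs ≡ length ys × Unique Cs ×
    All (L._∈ members F) Cs × All (λ C → ∃[ y ] (y L.∈ ys × Neighbour y C)) Cs ×
    All (λ y → Any (y ∉_) Cs) ys)
  neighbours [] _ _ = [] , refl , AllPairs.[] , [] , [] , []
  neighbours (y ∷ ys) (y∉ys AllPairs.∷ u) (y∈A ∷ ys∈A)
    with neighbours ys u ys∈A | full⇒neighbour A∈F full y∈A
  ... | Cs , len , Cs-unique , Cs∈F , nbr , avoid | C′ , C′∈F , A-y⊆C′ , y∉C′ =
    C′ ∷ Cs , cong suc len , All.map differs nbr AllPairs.∷ Cs-unique , C′∈F ∷ Cs∈F ,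
    (y , here refl , A-y⊆C′ , y∉C′) ∷ All.map (λ (z , z∈ , nb) → z , there z∈ , nb) nbr ,
    here y∉C′ ∷ All.map there avoid
    where
    differs : ∀ {D} → ∃[ z ] (z L.∈ ys × Neighbour z D) → C′ ≢ D
    differs (z , z∈ , A-z⊆D , _) refl = y∉C′ (A-z⊆D (x∈p∧x≢y⇒x∈p-y y∈A (All.lookup y∉ys z∈)))

  x∈A : x ∈ A
  x∈A = proj₁ (x∈p∩q⁻ A B x∈A∩B)

  -- Here `e` is d - 3. With `x` these are d - 2 points, so A, B and the neighbours are d sets in
  -- all.
  others : List (Fin n)
  others = take e (elements (A - x))

  ∣A∣ : ∣ A ∣ ≡ 3 + j
  ∣A∣ = All.lookup (uniform F) A∈F

  ∣A-y∣ : ∀ {y} → y ∈ A → ∣ A - y ∣ ≡ 2 + j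
  ∣A-y∣ y∈A = suc-injective (trans (sym (∣p∣≡1+∣p-x∣ y∈A)) ∣A∣)

  others∈ : All (_∈ (A - x)) others
  others∈ = All.take⁺ e (All.tabulate ∈-elements⁻)

  inA : All (_∈ A) (x ∷ others)
  inA = x∈A ∷ All.map (x∈p-y⇒x∈p {p = A}) others∈

  distinct : Unique (x ∷ others)
  distinct = All.map (λ { y∈ refl → x∉p-x {p = A} y∈ }) others∈
    AllPairs.∷ Unique.take⁺ e (elements-unique (A - x))

  length-others : length others ≡ e
  length-others = trans (length-take e (elements (A - x))) (m≤n⇒m⊓n≡m
    (≤-trans e≤j (≤-trans (m≤n+m j 2) (≤-reflexive (sym (trans (length-elements (A - x)) (∣A-y∣ x∈A)))))))

  ∣B∩∁A∣ : ∣ B ∩ ∁ A ∣ ≡ 2 + j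
  ∣B∩∁A∣ = suc-injective (trans
    (cong (_+ ∣ B ∩ ∁ A ∣) (trans (sym ∣A∩B∣≡1) (cong ∣_∣ (∩-comm A B))))
    (trans (sym (∣p∣≡∣p∩q∣+∣p∩∁q∣ B A)) (All.lookup (uniform F) B∈F)))

  refute : _ → _
  refute (Cs , len , Cs-unique , Cs∈F , nbr , (avoid ∷ _)) =
    cond (A ∷ B ∷ Cs , cong (2 +_) (trans len (cong suc length-others)) ,
      (A≢B ∷ All.map A≢C nbr) AllPairs.∷ (All.map B≢C nbr AllPairs.∷ Cs-unique) ,
      A∈F ∷ B∈F ∷ Cs∈F , union , empty)
    where
    A≢B : A ≢ B
    A≢B refl = contradiction (trans (sym ∣A∩B∣≡1) (trans (cong ∣_∣ (∩-idem A)) ∣A∣)) λ ()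
    A≢C : ∀ {D} → ∃[ y ] (y L.∈ x ∷ others × Neighbour y D) → A ≢ D
    A≢C (y , y∈ , _ , y∉D) refl = y∉D (All.lookup inA y∈)
    -- If B were the neighbour for y, then A ∩ B would contain A - y, which has at least two points.
    B≢C : ∀ {D} → ∃[ y ] (y L.∈ x ∷ others × Neighbour y D) → B ≢ D
    B≢C (y , y∈ , A-y⊆D , _) refl = contradiction
      (≤-trans (≤-reflexive (sym (∣A-y∣ (All.lookup inA y∈))))
        (≤-trans (p⊆q⇒∣p∣≤∣q∣ (λ z∈ → x∈p∩q⁺ (x∈p-y⇒x∈p {p = A} z∈ , A-y⊆D z∈))) (≤-reflexive ∣A∩B∣≡1)))
      λ { (s≤s ()) }
    extends : ∀ {D} → D L.∈ members F × ∃[ y ] (y L.∈ x ∷ others × Neighbour y D) → ∣ D ∩ ∁ A ∣ ≤ 1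
    extends {D} (D∈F , y , y∈ , A-y⊆D , _) = +-cancelˡ-≤ (2 + j) _ _ (begin
      2 + j + ∣ D ∩ ∁ A ∣           ≡⟨ cong (_+ ∣ D ∩ ∁ A ∣) (∣A-y∣ (All.lookup inA y∈)) ⟨
      ∣ A - y ∣ + ∣ D ∩ ∁ A ∣       ≤⟨ +-monoˡ-≤ _ (p⊆q⇒∣p∣≤∣q∣ (λ z∈ → x∈p∩q⁺ (A-y⊆D z∈ , x∈p-y⇒x∈p {p = A} z∈))) ⟩
      ∣ D ∩ A ∣ + ∣ D ∩ ∁ A ∣       ≡⟨ ∣p∣≡∣p∩q∣+∣p∩∁q∣ D A ⟨
      ∣ D ∣                         ≡⟨ All.lookup (uniform F) D∈F ⟩
      3 + j                         ≡⟨ +-comm 1 (2 + j) ⟩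
      2 + j + 1 ∎)
      where open ≤-Reasoning
    -- A has k points, B adds k - 1, and each of the d - 2 neighbours adds at most one: 2k + d - 3
    -- in total.
    union : ∣ ⋃ (A ∷ B ∷ Cs) ∣ ≤ (2 * (3 + j) + (3 + e)) ∸ 3
    union = begin
      ∣ A ∪ (B ∪ ⋃ Cs) ∣                          ≤⟨ ∣p∪q∣≤∣p∣+∣q∩∁p∣ A (B ∪ ⋃ Cs) ⟩
      ∣ A ∣ + ∣ (B ∪ ⋃ Cs) ∩ ∁ A ∣                ≤⟨ +-monoʳ-≤ ∣ A ∣ (∣[p∪q]∩r∣≤∣p∩r∣+∣q∩r∣ B (⋃ Cs) (∁ A)) ⟩
      ∣ A ∣ + (∣ B ∩ ∁ A ∣ + ∣ ⋃ Cs ∩ ∁ A ∣)      ≤⟨ +-monoʳ-≤ ∣ A ∣ (+-monoʳ-≤ ∣ B ∩ ∁ A ∣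
                                                       (∣⋃∩p∣≤length (∁ A) Cs (All.map extends (All.zip (Cs∈F , nbr))))) ⟩
      ∣ A ∣ + (∣ B ∩ ∁ A ∣ + length Cs)           ≡⟨ cong₂ _+_ ∣A∣ (cong₂ _+_ ∣B∩∁A∣ (trans len (cong suc length-others))) ⟩
      (3 + j) + ((2 + j) + (1 + e))               ≡⟨ m+n∸m≡n 3 _ ⟨
      3 + ((3 + j) + ((2 + j) + (1 + e))) ∸ 3     ≡⟨ cong (_∸ 3) (rearrange j e) ⟩
      (2 * (3 + j) + (3 + e)) ∸ 3 ∎
      where
      open ≤-Reasoning
      rearrange : ∀ j e → 3 + ((3 + j) + ((2 + j) + (1 + e))) ≡ 2 * (3 + j) + (3 + e)
      rearrange = solve-∀
    -- A common point would lie in A ∩ B and so be `x`, which some neighbour avoids.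
    empty : Empty (⋂ (A ∷ B ∷ Cs))
    empty (z , z∈) with L.find avoid
    ... | D , D∈ , x∉D = x∉D (subst (_∈ D) z≡x (⋂⊆ {qs = A ∷ B ∷ Cs} (there (there D∈)) z∈))
      where
      z≡x : z ≡ x
      z≡x = ∣p∣≡1⇒≡ ∣A∩B∣≡1 x∈A∩B (x∈p∩q⁺ (⋂⊆ {qs = A ∷ B ∷ Cs} (here refl) z∈ , ⋂⊆ {qs = A ∷ B ∷ Cs} (there (here refl)) z∈))

-- Assembling the bound

size≤C : ∀ {n} j e q → 4 * (3 + j) ^ 4 ≤ q → e ≤ j → (((q + 2) + j) + (3 + j)) ≡ n → (F : Family n (3 + j)) →
  ConditionallyIntersecting (3 + e) ((2 * (3 + j) + (3 + e)) ∸ 3) F → size F ≤ (n ∸ 1) C (2 + j)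
size≤C j e q 4k⁴≤q e≤j refl F cond = ≤-trans
  (size-bound (2 + j) m q _ _ _ _ _ counted privates+full
    (exceptional-bound j q 4k⁴≤q _ _ _ _ (#-pairs meets) (#-good meets)))
  (≤-reflexive (cong (λ z → (z ∸ 1) C (2 + j)) (sym n≡)))
  where
  -- This makes n = m + k, N = n - k + 1 = `suc m` and q = N - k, the largest extra weight that a
  -- good set of degree k can carry.
  m = (q + 2) + j
  open Fulls {j} {m} (members F) (unique F) (All.lookup (uniform F))
  meets = full-meets e≤j F cond
  n≡ : m + (3 + j) ≡ suc m + (2 + j)
  n≡ = +-suc m (2 + j)
  q+k≡1+m : q + (3 + j) ≡ suc m
  q+k≡1+m = lemma q j
    where
    lemma : ∀ q j → q + (3 + j) ≡ suc ((q + 2) + j)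
    lemma = solve-∀
  counted : (3 + j) * length (members F) + m * # private? shadows + q * # (other? meets) shadows
    ≤ suc m * ((suc m + (2 + j)) C (2 + j))
  counted = ≤-trans
    (weighted-count meets m q (trans (cong (_∸ (2 + j)) n≡) (m+n∸n≡m (suc m) (2 + j))) (≤-reflexive q+k≡1+m))
    (≤-reflexive (cong (λ z → suc m * (z C (2 + j))) n≡))

theorem1p8 : ∀ (n k d : ℕ) → 3 ≤ d → d ≤ k → 3 * k ^ 5 ≤ n →
    (F : Family n k) →
    ConditionallyIntersecting d ((2 * k + d) ∸ 3) F →
    size F ≤ (n ∸ 1) C (k ∸ 1)
theorem1p8 n (suc (suc (suc j))) (suc (suc (suc e))) (s≤s (s≤s (s≤s _))) (s≤s (s≤s (s≤s e≤j))) 3k⁵≤n F cond =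
  -- The value of q is n - 2k + 1; since n ≥ 3k⁵, it is at least 4k⁴ and the subtraction is not
  -- truncated.
  size≤C j e (n ∸ (5 + 2 * j)) (m+n≤o⇒m≤o∸n _ 4k⁴+≤n) e≤j n≡ F cond
  where
  4k⁴+≤n : 4 * (3 + j) ^ 4 + (5 + 2 * j) ≤ n
  4k⁴+≤n = n-decomposition j n 3k⁵≤n
  n≡ : ((n ∸ (5 + 2 * j)) + 2 + j) + (3 + j) ≡ n
  n≡ = trans (rearrange (n ∸ (5 + 2 * j)) j) (m∸n+n≡m (m+n≤o⇒n≤o (4 * (3 + j) ^ 4) 4k⁴+≤n))
    where
    rearrange : ∀ q j → (q + 2 + j) + (3 + j) ≡ q + (5 + 2 * j)
    rearrange = solve-∀
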